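{- For every unate DNF formula $f$ with width $w$ and size $m$ and every $\varepsilon>0$, there exist DNF formulae $f_\ell,f_u$, each with width $w$ and at most $(w\log(m/\varepsilon))^{O(w)}$ terms, which are $\varepsilon$-sandwiching approximators for $f$.
   Context: A term is an AND of literals; a DNF formula on $n$ variables is an OR of terms and computes a function $\{0,1\}^n\to\{0,1\}$. Its size is its number of terms and its width is the maximum number of literals in a term; a formula with width $w$ has at most $w$ literals in each term. A DNF formula is unate if it does not contain both a variable and its negation (anywhere in the formula). The constant implied by $O(w)$ is absolute. Functions $f_\ell,f_u:\{0,1\}^n\to\{0,1\}$ are $\varepsilon$-sandwiching approximators for $f$ if $f_\ell(x)\le f(x)\le f_u(x)$ for every $x\in\{0,1\}^n$, and $\Pr_x[f_\ell(x)\ne f(x)]\le\varepsilon$ and $\Pr_x[f_u(x)\ne f(x)]\le\varepsilon$ for $x$ uniform in $\{0,1\}^n$.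
   Formalization: The logarithm (base 2) is read as max(1, log(m/ε)), since for m/ε < 2 the stated bound can be undefined or less than 1 (e.g. f = x₁, ε = 1); ε is taken to be a positive rational, which is equivalent. -}

module Defs where

open import Data.Bool.Base using (Bool; true; false; not) renaming (_≤_ to _≤ᵇ_)
open import Data.Bool.ListAction using (all; any)
open import Data.Bool.Properties using (_≟_)
open import Data.Fin.Base using (Fin)
open import Data.Integer.Base using (ℤ; +_; -[1+_])
open import Data.List.Base using (List; []; _∷_; _++_; map; concat; length; filter)
open import Data.List.Extrema.Nat using (max)
open import Data.List.Membership.Propositional using (_∈_)
open import Data.Nat.Base as ℕ using (ℕ; zero; suc)
open import Data.Nat.Properties using (m^n≢0)
open import Data.Product.Base using (_×_)
open import Data.Rational.Base using (ℚ; _≤_; _*_; _/_; _÷_; 1ℚ; ½; ↥_; ↧ₙ_; Positive; +-*-rawSemiring)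
open import Data.Rational.Properties using (pos⇒nonZero)
open import Data.Vec.Base using (Vec; []; _∷_; lookup)
open import Relation.Binary.PropositionalEquality using (_≢_)
open import Relation.Nullary using (¬_; ¬?)
open import Relation.Unary using (Pred; Decidable)
open import Level using (0ℓ)

open import Algebra.Definitions.RawSemiring +-*-rawSemiring public using (_^_)

data Literal (n : ℕ) : Set where
  pos neg : Fin n → Literal n

Term : ℕ → Set
Term n = List (Literal n)

-- The empty term is the constant 1, the empty formula the constant 0.
DNF : ℕ → Set
DNF n = List (Term n)

Cube : ℕ → Set
Cube n = Vec Bool n

evalLiteral : ∀ {n} → Literal n → Cube n → Bool
evalLiteral (pos i) x = lookup x i
evalLiteral (neg i) x = not (lookup x i)

evalTerm : ∀ {n} → Term n → Cube n → Bool
evalTerm t x = all (λ l → evalLiteral l x) t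

⟦_⟧ : ∀ {n} → DNF n → Cube n → Bool
⟦ f ⟧ x = any (λ t → evalTerm t x) f

size : ∀ {n} → DNF n → ℕ
size = length

width : ∀ {n} → DNF n → ℕ
width f = max 0 (map length f)

Unate : ∀ {n} → DNF n → Set
Unate {n} f = (i : Fin n) → ¬ (pos i ∈ concat f × neg i ∈ concat f)

cube : (n : ℕ) → List (Cube n)
cube zero    = [] ∷ []
cube (suc n) = map (false ∷_) (cube n) ++ map (true ∷_) (cube n)

Pr : ∀ {n} {P : Pred (Cube n) 0ℓ} → Decidable P → ℚ
Pr {n} P? = _/_ (+ length (filter P? (cube n))) (2 ℕ.^ n) {{m^n≢0 2 n}}

_differs?_ : ∀ {n} (g f : Cube n → Bool) → Decidable (λ x → g x ≢ f x)
(g differs? f) x = ¬? (g x ≟ f x)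

record Sandwiching {n : ℕ} (ε : ℚ) (fℓ fᵤ f : Cube n → Bool) : Set where
  field
    lower       : ∀ x → fℓ x ≤ᵇ f x
    upper       : ∀ x → f x ≤ᵇ fᵤ x
    lower-error : Pr (fℓ differs? f) ≤ ε
    upper-error : Pr (fᵤ differs? f) ≤ ε

fromℕ : ℕ → ℚ
fromℕ k = + k / 1

2^ℤ_ : ℤ → ℚ
2^ℤ (+ a)    = fromℕ 2 ^ a
2^ℤ -[1+ a ] = ½ ^ suc a

-- For r ≥ 0 and q = a/b with b > 0, the real inequality log₂ r ≤ q
-- is r^b ≤ 2^a (with log₂ 0 = -∞).
log₂_≤_ : ℚ → ℚ → Set
log₂ r ≤ q = r ^ (↧ₙ q) ≤ 2^ℤ (↥ q)

-- The real inequality  N ≤ (w · max(1, log₂ r))^k, stated through the rational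
-- upper bounds q of max(1, log₂ r); by continuity of the power this is exact.
-- The logarithm is floored at 1 because the bound cannot hold otherwise: f = x₁
-- (so m = w = 1) with 1/2 < ε needs a nonzero upper approximator, hence N ≥ 1,
-- whereas log₂ (m/ε) < 1 would make the bound less than 1 for every k ≥ 1.
_≤[_·log₂_]^_ : ℕ → ℕ → ℚ → ℕ → Set
N ≤[ w ·log₂ r ]^ k = ∀ q → 1ℚ ≤ q → log₂ r ≤ q → fromℕ N ≤ (fromℕ w * q) ^ k

_over_ : ℕ → (ε : ℚ) → .{{Positive ε}} → ℚ
m over ε = _÷_ (fromℕ m) ε {{pos⇒nonZero ε}}

{-# OPTIONS --safe #-}
-- Flipping variables turns a unate DNF into a monotone one, a family F of sets of size at most w.
-- Fix t with m/ε ≤ 2^t and r = O(wt). While F has more than r^k sets of some size k, let Y be a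
-- largest set contained in more than r^(k-∣Y∣) of them. By maximality the sets s ∖ Y with Y ⊆ s are
-- r-spread, so by Chebyshev a random set of density 1/2t contains one of them with probability
-- at least 1/2; a uniform random set dominates the union of t such independent sets and hence
-- contains none of them with probability at most 2^-t. Thus deleting one of the sets containing Y
-- (lower approximator), or replacing all of them by Y (upper approximator), changes the formula with
-- probability at most 2^-t ≤ ε/m. Every step shortens F, so there are at most m steps, and at the end
-- at most (w+1) r^w sets remain.
module Submission where

open import Defs renaming (_^_ to _^ℚ_)
open import Algebra.Bundles using (module CommutativeRing)
open import Data.Bool.Base using (Bool; true; false; T; not; _∧_; _∨_; _xor_; b≤b; f≤t) renaming (_≤_ to _≤ᵇ_)
open import Data.Bool.ListAction using (any)
open import Data.Bool.Properties as Bool using (T?)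
open import Data.Fin.Base using (Fin; zero; suc)
import Data.Fin.Properties as Fin
open import Data.Fin.Subset using (∣_∣; _∪_; _∩_; _─_; ⊥)
open import Data.Fin.Subset.Properties using (∪-idem; ∣⊥∣≡0)
open import Data.Integer.Base as ℤ using (-[1+_])
import Data.Integer.Properties as ℤ
open import Data.List.Base using (List; []; _∷_; _++_; map; length; filter; filterᵇ; upTo; concat)
open import Data.List.Extrema.Nat using (argmax; argmax-all; f[xs]≤f[argmax]; max≤v⁺; xs≤max)
import Data.List.Membership.DecPropositional as DecMembership
open import Data.List.Membership.Propositional using (_∈_)
open import Data.List.Membership.Propositional.Properties using (∈-map⁺; ∈-map⁻; ∈-++⁺ˡ; ∈-++⁺ʳ; ∈-++⁻; ∈-filter⁺; ∈-upTo⁺; ∈-upTo⁻)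
open import Data.List.Properties using (length-map; length-upTo)
import Data.List.Relation.Unary.All as All
open import Data.List.Relation.Unary.All.Properties using (all-filter)
open import Data.List.Relation.Unary.Any using (here; there)
open import Data.Nat.Base hiding (_≤ᵇ_)
open import Data.Nat.Coprimality using (1-coprimeTo) renaming (sym to coprime-sym)
open import Data.Nat.Properties
open import Data.Nat.Tactic.RingSolver using (solve-∀)
open import Data.Product.Base using (Σ-syntax; _×_; _,_; proj₁; proj₂)
open import Data.Rational.Base as ℚ using (ℚ; mkℚ; 0ℚ; 1ℚ; *≤*; Positive; toℚᵘ)
import Data.Rational.Properties as ℚ
open import Data.Rational.Unnormalised.Base as ℚᵘ using (mkℚᵘ; *≡*)
import Data.Rational.Unnormalised.Properties as ℚᵘ
open import Data.Sum.Base using (_⊎_; inj₁; inj₂)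
open import Data.Vec.Base using ([]; _∷_; head; tail; lookup; tabulate; zipWith; _[_]≔_)
open import Data.Vec.Properties using (lookup-zipWith; lookup∘tabulate)
open import Function.Base using (_∘_; flip)
open import Relation.Binary.Definitions using (DecidableEquality)
open import Relation.Binary.PropositionalEquality using (_≡_; refl; sym; trans; cong; cong₂; subst; subst₂)
open import Relation.Nullary using (yes; no; does; contradiction)
open import Relation.Nullary.Decidable using (dec-true; dec-false; map′)
open import Relation.Unary using (Decidable)

open import Algebra.Properties.Semiring.Exp (CommutativeRing.semiring ℚ.+-*-commutativeRing) using () renaming (^-assocʳ to ^-assocʳℚ)

-- Sums and indicators

-- All averages are kept as integers with the denominators cleared, so the combinatorial part is a
-- chain of inequalities in ℕ. For the number X of sets inside a random set of density 1/d, the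
-- ratio of E[X²] to (E X)² is the average of d^∣s ∩ s′∣ over pairs of sets. Spreadness bounds it by
-- (1 + 1/R)^v with v ≤ w, and this is at most 3/2 once R ≥ 3w: hence the factor w in r = 2tR.
-- Chebyshev yields only the probability 1/2. Amplifying it to 2^-t by a union of t samples forces
-- the density of each down to 1/2t, so that the union still has density at most 1/2: hence the
-- factor t. The count around Y must be strictly more than r^(k-∣Y∣), because one set s is taken out
-- and the remaining ones must still be spread; they alone cover most of what Y covers, whether s is
-- deleted or Y is added. The last obstacle is the absolute constant. It can be moved into the
-- exponent only where w times the logarithm is bounded away from 1, which fails in width 1 and
-- makes that width a separate case.

𝟙 : Bool → ℕ
𝟙 true  = 1
𝟙 false = 0

𝟙≤1 : ∀ b → 𝟙 b ≤ 1
𝟙≤1 true  = ≤-refl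
𝟙≤1 false = z≤n

𝟙-+-not : ∀ b → 𝟙 b + 𝟙 (not b) ≡ 1
𝟙-+-not true  = refl
𝟙-+-not false = refl

𝟙-∧ : ∀ a b → 𝟙 (a ∧ b) ≡ 𝟙 a * 𝟙 b
𝟙-∧ true  b = sym (+-identityʳ (𝟙 b))
𝟙-∧ false b = refl

module _ {A : Set} where

  Σ : List A → (A → ℕ) → ℕ
  Σ []       h = 0
  Σ (a ∷ as) h = h a + Σ as h

  Σ-mono∈ : ∀ as {g h} → (∀ {a} → a ∈ as → g a ≤ h a) → Σ as g ≤ Σ as h
  Σ-mono∈ []       g≤h = z≤n
  Σ-mono∈ (a ∷ as) g≤h = +-mono-≤ (g≤h (here refl)) (Σ-mono∈ as (g≤h ∘ there))

  Σ-mono : ∀ as {g h} → (∀ a → g a ≤ h a) → Σ as g ≤ Σ as h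
  Σ-mono as g≤h = Σ-mono∈ as (λ {a} _ → g≤h a)

  Σ-cong∈ : ∀ as {g h} → (∀ {a} → a ∈ as → g a ≡ h a) → Σ as g ≡ Σ as h
  Σ-cong∈ []       g≡h = refl
  Σ-cong∈ (a ∷ as) g≡h = cong₂ _+_ (g≡h (here refl)) (Σ-cong∈ as (g≡h ∘ there))

  Σ-cong : ∀ as {g h} → (∀ a → g a ≡ h a) → Σ as g ≡ Σ as h
  Σ-cong as g≡h = Σ-cong∈ as (λ {a} _ → g≡h a)

  Σ-+ : ∀ as g h → Σ as (λ a → g a + h a) ≡ Σ as g + Σ as h
  Σ-+ []       g h = refl
  Σ-+ (a ∷ as) g h rewrite Σ-+ as g h = swap (g a) (h a) (Σ as g) (Σ as h)
    where
    swap : ∀ x y z u → x + y + (z + u) ≡ x + z + (y + u)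
    swap = solve-∀

  Σ-*ˡ : ∀ as c h → Σ as (λ a → c * h a) ≡ c * Σ as h
  Σ-*ˡ []       c h = sym (*-zeroʳ c)
  Σ-*ˡ (a ∷ as) c h rewrite Σ-*ˡ as c h = sym (*-distribˡ-+ c (h a) (Σ as h))

  Σ-*ʳ : ∀ as c h → Σ as (λ a → h a * c) ≡ Σ as h * c
  Σ-*ʳ as c h = trans (Σ-cong as (λ a → *-comm (h a) c)) (trans (Σ-*ˡ as c h) (*-comm c _))

  Σ-const : ∀ as c → Σ as (λ _ → c) ≡ length as * c
  Σ-const []       c = refl
  Σ-const (a ∷ as) c = cong (c +_) (Σ-const as c)

  Σ-∈ : ∀ {a as} → a ∈ as → ∀ h → h a ≤ Σ as h
  Σ-∈ (here refl)          h = m≤m+n _ _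
  Σ-∈ (there {x = b} a∈as) h = ≤-trans (Σ-∈ a∈as h) (m≤n+m _ (h b))

-- Weighted sums over the cube

-- (a+b)^n times the expectation of g at a random set of density a/(a+b).
wsum : (a b : ℕ) {n : ℕ} → (Cube n → ℕ) → ℕ
wsum a b {zero}  g = g []
wsum a b {suc n} g = b * wsum a b (g ∘ (false ∷_)) + a * wsum a b (g ∘ (true ∷_))

module _ (a b : ℕ) where

  wsum-mono : ∀ {n} {g h : Cube n → ℕ} → (∀ x → g x ≤ h x) → wsum a b g ≤ wsum a b h
  wsum-mono {zero}  g≤h = g≤h []
  wsum-mono {suc n} g≤h =
    +-mono-≤ (*-monoʳ-≤ b (wsum-mono (g≤h ∘ (false ∷_)))) (*-monoʳ-≤ a (wsum-mono (g≤h ∘ (true ∷_))))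

  wsum-cong : ∀ {n} {g h : Cube n → ℕ} → (∀ x → g x ≡ h x) → wsum a b g ≡ wsum a b h
  wsum-cong g≡h = ≤-antisym (wsum-mono (≤-reflexive ∘ g≡h)) (wsum-mono (≤-reflexive ∘ sym ∘ g≡h))

  wsum-0 : ∀ {n} → wsum a b {n} (λ _ → 0) ≡ 0
  wsum-0 {zero}  = refl
  wsum-0 {suc n} rewrite wsum-0 {n} | *-zeroʳ b | *-zeroʳ a = refl

  wsum-1 : ∀ {n} → wsum a b {n} (λ _ → 1) ≡ (b + a) ^ n
  wsum-1 {zero}  = refl
  wsum-1 {suc n} rewrite wsum-1 {n} = sym (*-distribʳ-+ ((b + a) ^ n) b a)

  wsum-+ : ∀ {n} (g h : Cube n → ℕ) → wsum a b (λ x → g x + h x) ≡ wsum a b g + wsum a b h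
  wsum-+ {zero}  g h = refl
  wsum-+ {suc n} g h
    rewrite wsum-+ (g ∘ (false ∷_)) (h ∘ (false ∷_)) | wsum-+ (g ∘ (true ∷_)) (h ∘ (true ∷_)) = eq a b _ _ _ _
    where
    eq : ∀ a b x y z u → b * (x + y) + a * (z + u) ≡ b * x + a * z + (b * y + a * u)
    eq = solve-∀

  wsum-* : ∀ {n} c (g : Cube n → ℕ) → wsum a b (λ x → c * g x) ≡ c * wsum a b g
  wsum-* {zero}  c g = refl
  wsum-* {suc n} c g rewrite wsum-* c (g ∘ (false ∷_)) | wsum-* c (g ∘ (true ∷_)) = eq a b c _ _
    where
    eq : ∀ a b c x y → b * (c * x) + a * (c * y) ≡ c * (b * x + a * y)
    eq = solve-∀

  wsum-Σ : ∀ {n} {A : Set} (as : List A) (h : A → Cube n → ℕ) →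
           wsum a b (λ x → Σ as (λ e → h e x)) ≡ Σ as (λ e → wsum a b (h e))
  wsum-Σ {n} []   h = wsum-0 {n}
  wsum-Σ (e ∷ as) h = trans (wsum-+ (h e) _) (cong (wsum a b (h e) +_) (wsum-Σ as h))

-- A coordinate is absent from the union of two independent random sets only if it is absent from
-- both, with weight `b * b′`; the three other combinations make it present. Induction on
-- coordinates multiplies the averages.
wsum-submult : ∀ a b a′ b′ {n} {G g h : Cube n → ℕ} → (∀ x y → G (x ∪ y) ≤ g x * h y) →
               wsum (a * a′ + a * b′ + b * a′) (b * b′) G ≤ wsum a b g * wsum a′ b′ h
wsum-submult a b a′ b′ {zero}  G≤ = G≤ [] []
wsum-submult a b a′ b′ {suc n} {G} {g} {h} G≤ = begin
  b * b′ * G₀ + (a * a′ + a * b′ + b * a′) * G₁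
    ≡⟨ expand a b a′ b′ G₀ G₁ ⟩
  b * b′ * G₀ + (a * a′ * G₁ + a * b′ * G₁ + b * a′ * G₁)
    ≤⟨ +-mono-≤ (*-monoʳ-≤ (b * b′) (rec false false))
         (+-mono-≤ (+-mono-≤ (*-monoʳ-≤ (a * a′) (rec true true)) (*-monoʳ-≤ (a * b′) (rec true false)))
           (*-monoʳ-≤ (b * a′) (rec false true))) ⟩
  b * b′ * (g₀ * h₀) + (a * a′ * (g₁ * h₁) + a * b′ * (g₁ * h₀) + b * a′ * (g₀ * h₁))
    ≡⟨ collect a b a′ b′ g₀ g₁ h₀ h₁ ⟩
  (b * g₀ + a * g₁) * (b′ * h₀ + a′ * h₁) ∎
  where
  open ≤-Reasoning
  rec : ∀ i j → wsum (a * a′ + a * b′ + b * a′) (b * b′) (G ∘ ((i ∨ j) ∷_)) ≤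
                wsum a b (g ∘ (i ∷_)) * wsum a′ b′ (h ∘ (j ∷_))
  rec i j = wsum-submult a b a′ b′ (λ x y → G≤ (i ∷ x) (j ∷ y))
  G₀ = wsum (a * a′ + a * b′ + b * a′) (b * b′) (G ∘ (false ∷_))
  G₁ = wsum (a * a′ + a * b′ + b * a′) (b * b′) (G ∘ (true ∷_))
  g₀ = wsum a b (g ∘ (false ∷_))
  g₁ = wsum a b (g ∘ (true ∷_))
  h₀ = wsum a′ b′ (h ∘ (false ∷_))
  h₁ = wsum a′ b′ (h ∘ (true ∷_))
  expand : ∀ a b a′ b′ x y → b * b′ * x + (a * a′ + a * b′ + b * a′) * y ≡
                             b * b′ * x + (a * a′ * y + a * b′ * y + b * a′ * y)
  expand = solve-∀
  collect : ∀ a b a′ b′ x y z u →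
    b * b′ * (x * z) + (a * a′ * (y * u) + a * b′ * (y * z) + b * a′ * (x * u)) ≡
    (b * x + a * y) * (b′ * z + a′ * u)
  collect = solve-∀

-- The pair (a , e ^ t) is the density of the union of t independent random sets of density 1/(1+e).
wsum-pow : ∀ e t {n} {G : Cube n → ℕ} → (∀ x → G x ≤ 1) → (∀ x y → G (x ∪ y) ≤ G x * G y) →
           Σ[ a ∈ ℕ ] (a + e ^ t ≡ suc e ^ t × wsum a (e ^ t) G ≤ wsum 1 e G ^ t)
wsum-pow e zero {n} {G} G≤1 _ = 0 , refl , (begin
  wsum 0 1 G           ≤⟨ wsum-mono 0 1 G≤1 ⟩
  wsum 0 1 {n} (λ _ → 1) ≡⟨ wsum-1 0 1 {n} ⟩
  1 ^ n                ≡⟨ ^-zeroˡ n ⟩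
  1                    ∎)
  where open ≤-Reasoning
wsum-pow e (suc t) {G = G} G≤1 G-mult with wsum-pow e t G≤1 G-mult
... | a , a+eᵗ , le = 1 * a + 1 * e ^ t + e * a , total , (begin
  wsum (1 * a + 1 * e ^ t + e * a) (e * e ^ t) G ≤⟨ wsum-submult 1 e a (e ^ t) G-mult ⟩
  wsum 1 e G * wsum a (e ^ t) G                  ≤⟨ *-monoʳ-≤ (wsum 1 e G) le ⟩
  wsum 1 e G * wsum 1 e G ^ t                    ∎)
  where
  open ≤-Reasoning
  eq : ∀ a e x → 1 * a + 1 * x + e * a + e * x ≡ (1 + e) * (a + x)
  eq = solve-∀
  total : 1 * a + 1 * e ^ t + e * a + e * e ^ t ≡ suc e ^ suc t
  total = trans (eq a e (e ^ t)) (cong (suc e *_) a+eᵗ)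

-- The two sides differ by (b - a)(x - y).
chebyshev-sum : ∀ {a b x y} → a ≤ b → y ≤ x → (a + b) * (x + y) ≤ 2 * (b * x + a * y)
chebyshev-sum {a} {b} {x} {y} a≤b y≤x
  with δ , refl ← m≤n⇒∃[o]m+o≡n a≤b | γ , refl ← m≤n⇒∃[o]m+o≡n y≤x =
  m+n≤o⇒m≤o _ (≤-reflexive (eq a δ y γ))
  where
  eq : ∀ a δ y γ → (a + (a + δ)) * (y + γ + y) + δ * γ ≡ 2 * ((a + δ) * (y + γ) + a * y)
  eq = solve-∀

-- Lowering the density from 1/2 can only raise the average of a function that decreases under
-- union. In one coordinate this is `chebyshev-sum`, which takes the place of a coupling of the two
-- distributions.
wsum-antitone : ∀ {a b} → a ≤ b → ∀ {n} {G : Cube n → ℕ} → (∀ x y → G (x ∪ y) ≤ G x) →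
                wsum 1 1 G * (a + b) ^ n ≤ 2 ^ n * wsum a b G
wsum-antitone a≤b {zero} {G} anti = ≤-reflexive (trans (*-identityʳ (G [])) (sym (*-identityˡ (G []))))
wsum-antitone {a} {b} a≤b {suc n} {G} anti = begin
  (1 * G₀ + 1 * G₁) * ((a + b) * D)          ≡⟨ eq₁ G₀ G₁ (a + b) D ⟩
  (a + b) * (G₀ * D + G₁ * D)                ≤⟨ *-monoʳ-≤ (a + b) (+-mono-≤ (rec false) (rec true)) ⟩
  (a + b) * (2 ^ n * g₀ + 2 ^ n * g₁)        ≡⟨ eq₂ (a + b) (2 ^ n) g₀ g₁ ⟩
  2 ^ n * ((a + b) * (g₀ + g₁))              ≤⟨ *-monoʳ-≤ (2 ^ n) (chebyshev-sum a≤b g₁≤g₀) ⟩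
  2 ^ n * (2 * (b * g₀ + a * g₁))            ≡⟨ eq₃ (2 ^ n) _ ⟩
  2 * 2 ^ n * (b * g₀ + a * g₁)              ∎
  where
  open ≤-Reasoning
  D  = (a + b) ^ n
  G₀ = wsum 1 1 (G ∘ (false ∷_))
  G₁ = wsum 1 1 (G ∘ (true ∷_))
  g₀ = wsum a b (G ∘ (false ∷_))
  g₁ = wsum a b (G ∘ (true ∷_))
  rec : ∀ i → wsum 1 1 (G ∘ (i ∷_)) * D ≤ 2 ^ n * wsum a b (G ∘ (i ∷_))
  rec i = wsum-antitone a≤b (λ x y → subst (λ j → G (j ∷ (x ∪ y)) ≤ G (i ∷ x)) (Bool.∨-identityʳ i) (anti (i ∷ x) (false ∷ y)))
  g₁≤g₀ : g₁ ≤ g₀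
  g₁≤g₀ = wsum-mono a b (λ x → subst (λ z → G (true ∷ z) ≤ G (false ∷ x)) (∪-idem x) (anti (false ∷ x) (true ∷ x)))
  eq₁ : ∀ x y d D → (1 * x + 1 * y) * (d * D) ≡ d * (x * D + y * D)
  eq₁ = solve-∀
  eq₂ : ∀ d p x y → d * (p * x + p * y) ≡ p * (d * (x + y))
  eq₂ = solve-∀
  eq₃ : ∀ p z → p * (2 * z) ≡ 2 * p * z
  eq₃ = solve-∀

-- Sets as cube points

_⊑_ : ∀ {n} → Cube n → Cube n → Bool
[]          ⊑ []      = true
(false ∷ s) ⊑ (_ ∷ x) = s ⊑ x
(true  ∷ s) ⊑ (b ∷ x) = b ∧ s ⊑ x

infix 8 _⊑_

wsum-⊑ : ∀ e {n} (s : Cube n) → wsum 1 e (λ x → 𝟙 (s ⊑ x)) * suc e ^ ∣ s ∣ ≡ suc e ^ n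
wsum-⊑ e []          = refl
wsum-⊑ e {suc n} (false ∷ s) = trans (eq e (wsum 1 e (λ x → 𝟙 (s ⊑ x))) (suc e ^ ∣ s ∣)) (cong (suc e *_) (wsum-⊑ e s))
  where
  eq : ∀ e W p → (e * W + 1 * W) * p ≡ (1 + e) * (W * p)
  eq = solve-∀
wsum-⊑ e {suc n} (true ∷ s) rewrite wsum-0 1 e {n} =
  trans (eq e (wsum 1 e (λ x → 𝟙 (s ⊑ x))) (suc e ^ ∣ s ∣)) (cong (suc e *_) (wsum-⊑ e s))
  where
  eq : ∀ e W p → (e * 0 + 1 * W) * ((1 + e) * p) ≡ (1 + e) * (W * p)
  eq = solve-∀

⊑-∪ : ∀ {n} (s s′ x : Cube n) → 𝟙 ((s ∪ s′) ⊑ x) ≡ 𝟙 (s ⊑ x) * 𝟙 (s′ ⊑ x)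
⊑-∪ []          []           []          = refl
⊑-∪ (false ∷ s) (false ∷ s′) (b ∷ x)     = ⊑-∪ s s′ x
⊑-∪ (true  ∷ s) (false ∷ s′) (true ∷ x)  = ⊑-∪ s s′ x
⊑-∪ (true  ∷ s) (false ∷ s′) (false ∷ x) = refl
⊑-∪ (false ∷ s) (true ∷ s′)  (true ∷ x)  = ⊑-∪ s s′ x
⊑-∪ (false ∷ s) (true ∷ s′)  (false ∷ x) = sym (*-zeroʳ (𝟙 (s ⊑ x)))
⊑-∪ (true  ∷ s) (true ∷ s′)  (true ∷ x)  = ⊑-∪ s s′ x
⊑-∪ (true  ∷ s) (true ∷ s′)  (false ∷ x) = refl

∣∪∣+∣∩∣ : ∀ {n} (s s′ : Cube n) → ∣ s ∪ s′ ∣ + ∣ s ∩ s′ ∣ ≡ ∣ s ∣ + ∣ s′ ∣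
∣∪∣+∣∩∣ []          []           = refl
∣∪∣+∣∩∣ (false ∷ s) (false ∷ s′) = ∣∪∣+∣∩∣ s s′
∣∪∣+∣∩∣ (true  ∷ s) (false ∷ s′) = cong suc (∣∪∣+∣∩∣ s s′)
∣∪∣+∣∩∣ (false ∷ s) (true ∷ s′)  = trans (cong suc (∣∪∣+∣∩∣ s s′)) (sym (+-suc ∣ s ∣ ∣ s′ ∣))
∣∪∣+∣∩∣ (true  ∷ s) (true ∷ s′)  = cong suc (trans (+-suc _ _) (trans (cong suc (∣∪∣+∣∩∣ s s′)) (sym (+-suc ∣ s ∣ ∣ s′ ∣))))

-- Bernoulli's inequality and pair sums of spread families

bernoulli : ∀ R v → suc R ^ suc v ≤ R ^ v * suc R + v * suc R ^ v
bernoulli R zero = ≤-reflexive (eq R)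
  where
  eq : ∀ R → (1 + R) * 1 ≡ 1 * (1 + R) + 0
  eq = solve-∀
bernoulli R (suc v) = begin
  suc R * Q                              ≡⟨ eq₁ R Q ⟩
  R * Q + Q                              ≤⟨ +-monoˡ-≤ Q (*-monoʳ-≤ R (bernoulli R v)) ⟩
  R * (R ^ v * suc R + v * suc R ^ v) + Q ≤⟨ m+n≤o⇒m≤o _ (≤-reflexive (eq₂ R (R ^ v) (suc R ^ v) v)) ⟩
  R * R ^ v * suc R + suc v * Q          ∎
  where
  open ≤-Reasoning
  Q = suc R ^ suc v
  eq₁ : ∀ R Q → (1 + R) * Q ≡ R * Q + Q
  eq₁ = solve-∀
  eq₂ : ∀ R p q v → R * (p * (1 + R) + v * q) + (1 + R) * q + v * q ≡ R * p * (1 + R) + (1 + v) * ((1 + R) * q)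
  eq₂ = solve-∀

-- Bernoulli gives (1 - 1/(R+1))^v ≥ 1 - v/(R+1) ≥ c/(c+1). The case c = 2 serves the pair sum, the
-- case c = 1 the density of a union.
bernoulli-ratio : ∀ c R v → suc c * v ≤ suc R → c * suc R ^ v ≤ suc c * R ^ v
bernoulli-ratio c R v cv≤R = *-cancelˡ-≤ (suc R) (+-cancelʳ-≤ (suc R * P) _ _ (begin
  suc R * (c * P) + suc R * P                ≡⟨ eq₁ R c P ⟩
  suc c * (suc R * P)                        ≤⟨ *-monoʳ-≤ (suc c) (bernoulli R v) ⟩
  suc c * (R ^ v * suc R + v * P)            ≡⟨ eq₂ c (R ^ v) (suc R) v P ⟩
  suc R * (suc c * R ^ v) + suc c * v * P    ≤⟨ +-monoʳ-≤ (suc R * (suc c * R ^ v)) (*-monoˡ-≤ P cv≤R) ⟩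
  suc R * (suc c * R ^ v) + suc R * P        ∎))
  where
  open ≤-Reasoning
  P = suc R ^ v
  eq₁ : ∀ R c P → (1 + R) * (c * P) + (1 + R) * P ≡ (1 + c) * ((1 + R) * P)
  eq₁ = solve-∀
  eq₂ : ∀ c Q r v P → (1 + c) * (Q * r + v * P) ≡ r * ((1 + c) * Q) + (1 + c) * v * P
  eq₂ = solve-∀

⊑-tail : ∀ {n} (s : Cube n) x → 𝟙 (s ⊑ tail x) ≡ 𝟙 ((false ∷ s) ⊑ x)
⊑-tail s (_ ∷ x) = refl

-- Expand `d ^ ∣ s ∩ τ a ∣` over the subsets s′ of `s`: each contributes at most N / R^∣s′∣, and
-- these add up to N (1 + 1/R)^∣s∣. The expansion runs one coordinate at a time; the weights `u` let
-- the induction pass to the sets through a coordinate with the same `N`.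
spread-sum : ∀ {A : Set} (as : List A) (d R N : ℕ) {n} (τ : A → Cube n) (u : A → ℕ) (s : Cube n) →
             (∀ s′ → (d * R) ^ ∣ s′ ∣ * Σ as (λ a → u a * 𝟙 (s′ ⊑ τ a)) ≤ N) →
             R ^ ∣ s ∣ * Σ as (λ a → u a * d ^ ∣ s ∩ τ a ∣) ≤ N * suc R ^ ∣ s ∣
spread-sum as d R N τ u [] spread = begin
  1 * Σ as (λ a → u a * d ^ ∣ [] ∩ τ a ∣) ≡⟨ cong (1 *_) (Σ-cong as (λ a → cong (u a *_) (empty (τ a)))) ⟩
  1 * Σ as (λ a → u a * 𝟙 ([] ⊑ τ a))     ≤⟨ spread [] ⟩
  N                                       ≡⟨ *-identityʳ N ⟨
  N * 1                                   ∎
  where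
  open ≤-Reasoning
  empty : ∀ y → d ^ ∣ [] ∩ y ∣ ≡ 𝟙 ([] ⊑ y)
  empty [] = refl
spread-sum as d R N τ u (false ∷ s) spread = begin
  R ^ ∣ s ∣ * Σ as (λ a → u a * d ^ ∣ (false ∷ s) ∩ τ a ∣)
    ≡⟨ cong (R ^ ∣ s ∣ *_) (Σ-cong as (λ a → cong (u a *_) (skip (τ a)))) ⟩
  R ^ ∣ s ∣ * Σ as (λ a → u a * d ^ ∣ s ∩ tail (τ a) ∣)
    ≤⟨ spread-sum as d R N (tail ∘ τ) u s (λ s′ → begin
         (d * R) ^ ∣ s′ ∣ * Σ as (λ a → u a * 𝟙 (s′ ⊑ tail (τ a)))
           ≡⟨ cong ((d * R) ^ ∣ s′ ∣ *_) (Σ-cong as (λ a → cong (u a *_) (⊑-tail s′ (τ a)))) ⟩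
         (d * R) ^ ∣ s′ ∣ * Σ as (λ a → u a * 𝟙 ((false ∷ s′) ⊑ τ a))
           ≤⟨ spread (false ∷ s′) ⟩
         N ∎) ⟩
  N * suc R ^ ∣ s ∣ ∎
  where
  open ≤-Reasoning
  skip : ∀ y → d ^ ∣ (false ∷ s) ∩ y ∣ ≡ d ^ ∣ s ∩ tail y ∣
  skip (_ ∷ y) = refl
spread-sum as d R N τ u (true ∷ s) spread = begin
  R * P * Σ as (λ a → u a * d ^ ∣ (true ∷ s) ∩ τ a ∣)
    ≤⟨ *-monoʳ-≤ (R * P) (Σ-mono as (λ a → *-monoʳ-≤ (u a) (split (τ a)))) ⟩
  R * P * Σ as (λ a → u a * (e a + d * (𝟙 (head (τ a)) * e a)))
    ≡⟨ cong (R * P *_) (trans (Σ-cong as (λ a → *-distribˡ-+ (u a) (e a) _)) (Σ-+ as _ _)) ⟩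
  R * P * (Σ as (λ a → u a * e a) + B)
    ≡⟨ eq₁ R P (Σ as (λ a → u a * e a)) B ⟩
  R * (P * Σ as (λ a → u a * e a)) + P * (R * B)
    ≡⟨ cong (λ z → R * (P * Σ as (λ a → u a * e a)) + P * z)
         (trans (sym (Σ-*ˡ as R _)) (Σ-cong as (λ a → eq₂ R (u a) d (𝟙 (head (τ a))) (e a)))) ⟩
  R * (P * Σ as (λ a → u a * e a)) + P * Σ as (λ a → u′ a * e a)
    ≤⟨ +-mono-≤ (*-monoʳ-≤ R (spread-sum as d R N (tail ∘ τ) u s spread₀)) (spread-sum as d R N (tail ∘ τ) u′ s spread₁) ⟩
  R * (N * Q) + N * Q
    ≡⟨ eq₃ R N Q ⟩
  N * (suc R * Q) ∎
  where
  open ≤-Reasoning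
  P = R ^ ∣ s ∣
  Q = suc R ^ ∣ s ∣
  e : _ → ℕ
  e a = d ^ ∣ s ∩ tail (τ a) ∣
  -- Only the sets through the first coordinate, scaled by the `d * R` that the hypothesis grants
  -- for one more element.
  u′ : _ → ℕ
  u′ a = d * R * (u a * 𝟙 (head (τ a)))
  B = Σ as (λ a → u a * (d * (𝟙 (head (τ a)) * e a)))
  split : ∀ y → d ^ ∣ (true ∷ s) ∩ y ∣ ≤ d ^ ∣ s ∩ tail y ∣ + d * (𝟙 (head y) * d ^ ∣ s ∩ tail y ∣)
  split (true ∷ y)  = ≤-trans (≤-reflexive (cong (d *_) (sym (*-identityˡ (d ^ ∣ s ∩ y ∣))))) (m≤n+m _ (d ^ ∣ s ∩ y ∣))
  split (false ∷ y) = m≤m+n _ _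
  ⊑-head : ∀ s′ y → 𝟙 (head y) * 𝟙 (s′ ⊑ tail y) ≡ 𝟙 ((true ∷ s′) ⊑ y)
  ⊑-head s′ (b ∷ y) = sym (𝟙-∧ b (s′ ⊑ y))
  spread₀ : ∀ s′ → (d * R) ^ ∣ s′ ∣ * Σ as (λ a → u a * 𝟙 (s′ ⊑ tail (τ a))) ≤ N
  spread₀ s′ = ≤-trans
    (≤-reflexive (cong ((d * R) ^ ∣ s′ ∣ *_) (Σ-cong as (λ a → cong (u a *_) (⊑-tail s′ (τ a))))))
    (spread (false ∷ s′))
  spread₁ : ∀ s′ → (d * R) ^ ∣ s′ ∣ * Σ as (λ a → u′ a * 𝟙 (s′ ⊑ tail (τ a))) ≤ N
  spread₁ s′ = begin
    r ^ ∣ s′ ∣ * Σ as (λ a → u′ a * 𝟙 (s′ ⊑ tail (τ a)))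
      ≡⟨ cong (r ^ ∣ s′ ∣ *_) (Σ-cong as (λ a →
           trans (eq₄ r (u a) (𝟙 (head (τ a))) _) (cong (λ z → r * (u a * z)) (⊑-head s′ (τ a))))) ⟩
    r ^ ∣ s′ ∣ * Σ as (λ a → r * (u a * 𝟙 ((true ∷ s′) ⊑ τ a)))
      ≡⟨ cong (r ^ ∣ s′ ∣ *_) (Σ-*ˡ as r _) ⟩
    r ^ ∣ s′ ∣ * (r * Σ as (λ a → u a * 𝟙 ((true ∷ s′) ⊑ τ a)))
      ≡⟨ eq₅ (r ^ ∣ s′ ∣) r _ ⟩
    r * r ^ ∣ s′ ∣ * Σ as (λ a → u a * 𝟙 ((true ∷ s′) ⊑ τ a))
      ≤⟨ spread (true ∷ s′) ⟩
    N ∎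
    where
    r = d * R
    eq₄ : ∀ r u h z → r * (u * h) * z ≡ r * (u * (h * z))
    eq₄ = solve-∀
    eq₅ : ∀ p r z → p * (r * z) ≡ r * p * z
    eq₅ = solve-∀
  eq₁ : ∀ R P A B → R * P * (A + B) ≡ R * (P * A) + P * (R * B)
  eq₁ = solve-∀
  eq₂ : ∀ R u d h e → R * (u * (d * (h * e))) ≡ d * R * (u * h) * e
  eq₂ = solve-∀
  eq₃ : ∀ R N Q → R * (N * Q) + N * Q ≡ N * ((1 + R) * Q)
  eq₃ = solve-∀

-- Families of sets as monotone formulas

hits : ∀ {n} → List (Cube n) → Cube n → Bool
hits F x = any (_⊑ x) F

hits-intro : ∀ {n} {F : List (Cube n)} {s x} → s ∈ F → s ⊑ x ≡ true → hits F x ≡ true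
hits-intro {x = x} (here {xs = F} refl) s⊑x rewrite s⊑x = refl
hits-intro {x = x} (there {x = s′} s∈F) s⊑x with s′ ⊑ x
... | true  = refl
... | false = hits-intro s∈F s⊑x

hits-elim : ∀ {n} (F : List (Cube n)) {x} → hits F x ≡ true → Σ[ s ∈ Cube n ] (s ∈ F × s ⊑ x ≡ true)
hits-elim (s ∷ F) {x} h with s ⊑ x in eq
... | true  = s , here refl , eq
... | false with s′ , s′∈F , s′⊑x ← hits-elim F h = s′ , there s′∈F , s′⊑x

misses : ∀ {n} → List (Cube n) → Cube n → ℕ
misses F x = 𝟙 (not (hits F x))

𝟙-not-anti : ∀ {a b} → (a ≡ true → b ≡ true) → 𝟙 (not b) ≤ 𝟙 (not a)
𝟙-not-anti {false}         a⇒b = 𝟙≤1 _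
𝟙-not-anti {true} {true}   a⇒b = z≤n
𝟙-not-anti {true} {false}  a⇒b with () ← a⇒b refl

⊑-∪⁺ˡ : ∀ {n} (s x y : Cube n) → s ⊑ x ≡ true → s ⊑ (x ∪ y) ≡ true
⊑-∪⁺ˡ []          []          []      _ = refl
⊑-∪⁺ˡ (false ∷ s) (_ ∷ x)     (_ ∷ y) p = ⊑-∪⁺ˡ s x y p
⊑-∪⁺ˡ (true ∷ s)  (true ∷ x)  (_ ∷ y) p = ⊑-∪⁺ˡ s x y p

⊑-∪⁺ʳ : ∀ {n} (s x y : Cube n) → s ⊑ y ≡ true → s ⊑ (x ∪ y) ≡ true
⊑-∪⁺ʳ []          []          []         _ = refl
⊑-∪⁺ʳ (false ∷ s) (_ ∷ x)     (_ ∷ y)    p = ⊑-∪⁺ʳ s x y p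
⊑-∪⁺ʳ (true ∷ s)  (true ∷ x)  (true ∷ y) p = ⊑-∪⁺ʳ s x y p
⊑-∪⁺ʳ (true ∷ s)  (false ∷ x) (true ∷ y) p = ⊑-∪⁺ʳ s x y p

hits-mono : ∀ {n} (F : List (Cube n)) {x z} → (∀ s → s ⊑ x ≡ true → s ⊑ z ≡ true) → hits F x ≡ true → hits F z ≡ true
hits-mono F x⇒z h with s , s∈F , s⊑x ← hits-elim F h = hits-intro s∈F (x⇒z s s⊑x)

module _ {n} (F : List (Cube n)) where

  -- A union that contains no set of the family has no part containing one; this is the
  -- submultiplicativity that `wsum-pow` raises to the power t.
  misses-∪ : ∀ x y → misses F (x ∪ y) ≤ misses F x * misses F y
  misses-∪ x y = go (hits-mono F (λ s → ⊑-∪⁺ˡ s x y)) (hits-mono F (λ s → ⊑-∪⁺ʳ s x y))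
    where
    go : ∀ {a b c} → (a ≡ true → c ≡ true) → (b ≡ true → c ≡ true) → 𝟙 (not c) ≤ 𝟙 (not a) * 𝟙 (not b)
    go {c = true}                  p q = z≤n
    go {true}  {c = false}         p q with () ← p refl
    go {false} {true}  {c = false} p q with () ← q refl
    go {false} {false} {c = false} p q = ≤-refl

  misses-antitone : ∀ x y → misses F (x ∪ y) ≤ misses F x
  misses-antitone x y = 𝟙-not-anti (hits-mono F (λ s → ⊑-∪⁺ˡ s x y))

Σ-missed : ∀ {n} (G : List (Cube n)) {x} → hits G x ≡ false → Σ G (λ s → 𝟙 (s ⊑ x)) ≡ 0
Σ-missed []          _ = refl
Σ-missed (s ∷ G) {x} h with s ⊑ x
... | false = Σ-missed G h

-- The second moment method and robust sunflowers

^-distribʳ-* : ∀ k a b → (a * b) ^ k ≡ a ^ k * b ^ k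
^-distribʳ-* zero    a b = refl
^-distribʳ-* (suc k) a b = trans (cong (a * b *_) (^-distribʳ-* k a b)) (eq a b (a ^ k) (b ^ k))
  where
  eq : ∀ a b x y → a * b * (x * y) ≡ a * x * (b * y)
  eq = solve-∀

am-gm : ∀ a b → 2 * (a * b) ≤ a * a + b * b
am-gm a b with ≤-total a b
... | inj₁ a≤b with δ , refl ← m≤n⇒∃[o]m+o≡n a≤b = m+n≤o⇒m≤o _ (≤-reflexive (eq a δ))
  where
  eq : ∀ a δ → 2 * (a * (a + δ)) + δ * δ ≡ a * a + (a + δ) * (a + δ)
  eq = solve-∀
... | inj₂ b≤a with δ , refl ← m≤n⇒∃[o]m+o≡n b≤a = m+n≤o⇒m≤o _ (≤-reflexive (eq b δ))
  where
  eq : ∀ b δ → 2 * ((b + δ) * b) + δ * δ ≡ (b + δ) * (b + δ) + b * b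
  eq = solve-∀

-- `d` is the reciprocal of the sampling density: each element costs a factor `d` in probability,
-- while fixing it thins the family by `d * R`. Families are lists, and repeated sets count with
-- multiplicity.
record Spread {n : ℕ} (d R v : ℕ) (G : List (Cube n)) : Set where
  field
    nonempty : 0 < length G
    uniform  : ∀ {s} → s ∈ G → ∣ s ∣ ≡ v
    spread   : ∀ s → (d * R) ^ ∣ s ∣ * Σ G (λ s′ → 𝟙 (s ⊑ s′)) ≤ length G

module SecondMoment {n : ℕ} (e R v : ℕ) {G : List (Cube n)} (S : Spread (suc e) R v G) (3v≤R : 3 * v ≤ suc R) where
  open Spread S
  open ≤-Reasoning

  private
    d = suc e
    N = length G
    D = d ^ v

    X : Cube n → ℕ
    X x = Σ G (λ s → 𝟙 (s ⊑ x))

    pairs : ℕ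
    pairs = Σ G (λ s → Σ G (λ s′ → d ^ ∣ s ∩ s′ ∣))

  first-moment : D * wsum 1 e X ≡ N * d ^ n
  first-moment = begin-equality
    D * wsum 1 e X                                      ≡⟨ cong (D *_) (wsum-Σ 1 e {n} G _) ⟩
    D * Σ G (λ s → wsum 1 e (λ x → 𝟙 (s ⊑ x)))          ≡⟨ Σ-*ˡ G D _ ⟨
    Σ G (λ s → D * wsum 1 e (λ x → 𝟙 (s ⊑ x)))          ≡⟨ Σ-cong∈ G (λ {s} s∈G →
      trans (*-comm D _) (trans (cong (λ k → wsum 1 e (λ x → 𝟙 (s ⊑ x)) * d ^ k) (sym (uniform s∈G))) (wsum-⊑ e s))) ⟩
    Σ G (λ _ → d ^ n)                                   ≡⟨ Σ-const G _ ⟩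
    N * d ^ n                                           ∎

  pair-moment : ∀ {s s′} → s ∈ G → s′ ∈ G →
                D * D * wsum 1 e (λ x → 𝟙 (s ⊑ x) * 𝟙 (s′ ⊑ x)) ≡ d ^ n * d ^ ∣ s ∩ s′ ∣
  pair-moment {s} {s′} s∈G s′∈G = begin-equality
    D * D * wsum 1 e (λ x → 𝟙 (s ⊑ x) * 𝟙 (s′ ⊑ x))
      ≡⟨ cong₂ _*_ powers (wsum-cong 1 e (sym ∘ ⊑-∪ s s′)) ⟩
    d ^ ∣ s ∪ s′ ∣ * d ^ ∣ s ∩ s′ ∣ * W
      ≡⟨ eq (d ^ ∣ s ∪ s′ ∣) (d ^ ∣ s ∩ s′ ∣) W ⟩
    W * d ^ ∣ s ∪ s′ ∣ * d ^ ∣ s ∩ s′ ∣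
      ≡⟨ cong (_* d ^ ∣ s ∩ s′ ∣) (wsum-⊑ e (s ∪ s′)) ⟩
    d ^ n * d ^ ∣ s ∩ s′ ∣ ∎
    where
    W = wsum 1 e (λ x → 𝟙 ((s ∪ s′) ⊑ x))
    eq : ∀ a b w → a * b * w ≡ w * a * b
    eq = solve-∀
    powers : D * D ≡ d ^ ∣ s ∪ s′ ∣ * d ^ ∣ s ∩ s′ ∣
    powers = begin-equality
      D * D                               ≡⟨ ^-distribˡ-+-* d v v ⟨
      d ^ (v + v)                         ≡⟨ cong (d ^_) (cong₂ _+_ (sym (uniform s∈G)) (sym (uniform s′∈G))) ⟩
      d ^ (∣ s ∣ + ∣ s′ ∣)                 ≡⟨ cong (d ^_) (∣∪∣+∣∩∣ s s′) ⟨
      d ^ (∣ s ∪ s′ ∣ + ∣ s ∩ s′ ∣)        ≡⟨ ^-distribˡ-+-* d ∣ s ∪ s′ ∣ ∣ s ∩ s′ ∣ ⟩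
      d ^ ∣ s ∪ s′ ∣ * d ^ ∣ s ∩ s′ ∣      ∎

  second-moment : D * D * wsum 1 e (λ x → X x * X x) ≡ d ^ n * pairs
  second-moment = begin-equality
    D * D * wsum 1 e (λ x → X x * X x)
      ≡⟨ cong (D * D *_) (wsum-cong 1 e (λ x → trans (sym (Σ-*ʳ G (X x) _)) (Σ-cong G (λ s → sym (Σ-*ˡ G (𝟙 (s ⊑ x)) _))))) ⟩
    D * D * wsum 1 e (λ x → Σ G (λ s → Σ G (λ s′ → 𝟙 (s ⊑ x) * 𝟙 (s′ ⊑ x))))
      ≡⟨ cong (D * D *_) (trans (wsum-Σ 1 e {n} G _) (Σ-cong G (λ s → wsum-Σ 1 e {n} G _))) ⟩
    D * D * Σ G (λ s → Σ G (λ s′ → wsum 1 e (λ x → 𝟙 (s ⊑ x) * 𝟙 (s′ ⊑ x))))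
      ≡⟨ trans (sym (Σ-*ˡ G (D * D) _)) (Σ-cong G (λ s → sym (Σ-*ˡ G (D * D) _))) ⟩
    Σ G (λ s → Σ G (λ s′ → D * D * wsum 1 e (λ x → 𝟙 (s ⊑ x) * 𝟙 (s′ ⊑ x))))
      ≡⟨ Σ-cong∈ G (λ s∈G → Σ-cong∈ G (λ s′∈G → pair-moment s∈G s′∈G)) ⟩
    Σ G (λ s → Σ G (λ s′ → d ^ n * d ^ ∣ s ∩ s′ ∣))
      ≡⟨ trans (Σ-cong G (λ s → Σ-*ˡ G (d ^ n) _)) (Σ-*ˡ G (d ^ n) _) ⟩
    d ^ n * pairs ∎

  -- This is E[X²] ≤ 3/2 (E X)². By `spread-sum` each row of the pair sum is at most N (1 + 1/R)^v,
  -- and 3v ≤ R + 1 makes the factor at most 3/2.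
  pairs-bound : .{{NonZero R}} → 2 * pairs ≤ 3 * (N * N)
  pairs-bound = *-cancelˡ-≤ (R ^ v) {{m^n≢0 R v}} (begin
    R ^ v * (2 * pairs)              ≡⟨ eq₁ (R ^ v) pairs ⟩
    2 * (R ^ v * pairs)              ≡⟨ cong (2 *_) (sym (Σ-*ˡ G (R ^ v) _)) ⟩
    2 * Σ G (λ s → R ^ v * Σ G (λ s′ → d ^ ∣ s ∩ s′ ∣))
                                     ≤⟨ *-monoʳ-≤ 2 (Σ-mono∈ G row) ⟩
    2 * Σ G (λ _ → N * suc R ^ v)    ≡⟨ cong (2 *_) (Σ-const G _) ⟩
    2 * (N * (N * suc R ^ v))        ≡⟨ eq₂ N (suc R ^ v) ⟩
    N * N * (2 * suc R ^ v)          ≤⟨ *-monoʳ-≤ (N * N) (bernoulli-ratio 2 R v 3v≤R) ⟩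
    N * N * (3 * R ^ v)              ≡⟨ eq₃ N (R ^ v) ⟩
    R ^ v * (3 * (N * N))            ∎)
    where
    eq₁ : ∀ a b → a * (2 * b) ≡ 2 * (a * b)
    eq₁ = solve-∀
    eq₂ : ∀ N q → 2 * (N * (N * q)) ≡ N * N * (2 * q)
    eq₂ = solve-∀
    eq₃ : ∀ N q → N * N * (3 * q) ≡ q * (3 * (N * N))
    eq₃ = solve-∀
    row : ∀ {s} → s ∈ G → R ^ v * Σ G (λ s′ → d ^ ∣ s ∩ s′ ∣) ≤ N * suc R ^ v
    row {s} s∈G = subst (λ k → R ^ k * Σ G (λ s′ → d ^ ∣ s ∩ s′ ∣) ≤ N * suc R ^ k) (uniform s∈G) (begin
      R ^ ∣ s ∣ * Σ G (λ s′ → d ^ ∣ s ∩ s′ ∣)       ≡⟨ cong (R ^ ∣ s ∣ *_) (Σ-cong G (λ s′ → sym (*-identityˡ _))) ⟩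
      R ^ ∣ s ∣ * Σ G (λ s′ → 1 * d ^ ∣ s ∩ s′ ∣)
        ≤⟨ spread-sum G d R N (λ s′ → s′) (λ _ → 1) s
             (λ s″ → ≤-trans (≤-reflexive (cong ((d * R) ^ ∣ s″ ∣ *_) (Σ-cong G (λ _ → *-identityˡ _)))) (spread s″)) ⟩
      N * suc R ^ ∣ s ∣                              ∎)

  -- Where the family is missed, X = 0 and (D X - N)² = N²; elsewhere the square is nonnegative,
  -- which is `am-gm`. The mixed term of the square stands on the left to avoid subtraction.
  chebyshev-pointwise : ∀ x → N * N * misses G x + 2 * N * D * X x ≤ D * D * (X x * X x) + N * N * 1
  chebyshev-pointwise x with hits G x in eq
  ... | true  = begin
    N * N * 0 + 2 * N * D * X x          ≡⟨ eq₁ N D (X x) ⟩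
    2 * (D * X x * N)                    ≤⟨ am-gm (D * X x) N ⟩
    D * X x * (D * X x) + N * N          ≡⟨ eq₂ N D (X x) ⟩
    D * D * (X x * X x) + N * N * 1      ∎
    where
    eq₁ : ∀ N D X → N * N * 0 + 2 * N * D * X ≡ 2 * (D * X * N)
    eq₁ = solve-∀
    eq₂ : ∀ N D X → D * X * (D * X) + N * N ≡ D * D * (X * X) + N * N * 1
    eq₂ = solve-∀
  ... | false rewrite Σ-missed G eq = ≤-reflexive (eq₁ N D)
    where
    eq₁ : ∀ N D → N * N * 1 + 2 * N * D * 0 ≡ D * D * 0 + N * N * 1
    eq₁ = solve-∀

  -- Averaging the pointwise bound gives N² Pr[miss] ≤ (3/2 - 2 + 1) N² = N²/2.
  misses-sparse : .{{NonZero R}} → 2 * wsum 1 e (misses G) ≤ d ^ n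
  misses-sparse = *-cancelˡ-≤ (N * N) {{m*n≢0 N N {{>-nonZero nonempty}} {{>-nonZero nonempty}}}}
    (+-cancelʳ-≤ (4 * (N * N) * d ^ n) _ _ (begin
    N * N * (2 * M) + 4 * (N * N) * d ^ n                  ≡⟨ eq₁ N M (d ^ n) ⟩
    2 * (N * N * M + 2 * N * (N * d ^ n))                  ≡⟨ cong (λ z → 2 * (N * N * M + 2 * N * z)) first-moment ⟨
    2 * (N * N * M + 2 * N * (D * wsum 1 e X))             ≡⟨ cong (λ z → 2 * (N * N * M + z)) (sym (*-assoc (2 * N) D _)) ⟩
    2 * (N * N * M + 2 * N * D * wsum 1 e X)               ≡⟨ cong (2 *_) (trans (wsum-+ 1 e {n} _ _) (cong₂ _+_ (wsum-* 1 e {n} (N * N) _) (wsum-* 1 e {n} (2 * N * D) X))) ⟨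
    2 * wsum 1 e (λ x → N * N * misses G x + 2 * N * D * X x)
                                                           ≤⟨ *-monoʳ-≤ 2 (wsum-mono 1 e chebyshev-pointwise) ⟩
    2 * wsum 1 e (λ x → D * D * (X x * X x) + N * N * 1)   ≡⟨ cong (2 *_) (trans (wsum-+ 1 e {n} _ _) (cong₂ _+_ (wsum-* 1 e {n} (D * D) _) (wsum-* 1 e {n} (N * N) _))) ⟩
    2 * (D * D * wsum 1 e (λ x → X x * X x) + N * N * wsum 1 e {n} (λ _ → 1))
                                                           ≡⟨ cong₂ (λ y z → 2 * (y + N * N * z)) second-moment (trans (wsum-1 1 e {n}) (cong (_^ n) (+-comm e 1))) ⟩
    2 * (d ^ n * pairs + N * N * d ^ n)                    ≡⟨ eq₂ N pairs (d ^ n) ⟩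
    d ^ n * (2 * pairs) + 2 * (N * N) * d ^ n              ≤⟨ +-monoˡ-≤ _ (*-monoʳ-≤ (d ^ n) pairs-bound) ⟩
    d ^ n * (3 * (N * N)) + 2 * (N * N) * d ^ n            ≡⟨ eq₃ N (d ^ n) ⟩
    N * N * d ^ n + 4 * (N * N) * d ^ n                    ∎))
    where
    M = wsum 1 e (misses G)
    eq₁ : ∀ N M p → N * N * (2 * M) + 4 * (N * N) * p ≡ 2 * (N * N * M + 2 * N * (N * p))
    eq₁ = solve-∀
    eq₂ : ∀ N q p → 2 * (p * q + N * N * p) ≡ p * (2 * q) + 2 * (N * N) * p
    eq₂ = solve-∀
    eq₃ : ∀ N p → p * (3 * (N * N)) + 2 * (N * N) * p ≡ N * N * p + 4 * (N * N) * p
    eq₃ = solve-∀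

robust-sunflower : ∀ t .{{_ : NonZero t}} {R v n} .{{_ : NonZero R}} {G : List (Cube n)} →
                   Spread (2 * t) R v G → 3 * v ≤ suc R → wsum 1 1 (misses G) * 2 ^ t ≤ 2 ^ n
-- `t′ + 1 * t` is 2t - 1, in the form whose successor is `2 * t` by computation.
robust-sunflower t@(suc t′) {R} {v} {n} {G} S 3v≤R with wsum-pow (t′ + 1 * t) t (λ x → 𝟙≤1 _) (misses-∪ G)
... | a , total , le = *-cancelʳ-≤ _ _ (dᵗ ^ n) {{m^n≢0 dᵗ n {{m^n≢0 (2 * t) t}}}} (begin
  W * 2 ^ t * dᵗ ^ n             ≡⟨ eq₁ W (2 ^ t) (dᵗ ^ n) ⟩
  2 ^ t * (W * dᵗ ^ n)           ≡⟨ cong (λ z → 2 ^ t * (W * z ^ n)) (sym total) ⟩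
  2 ^ t * (W * (a + e ^ t) ^ n)  ≤⟨ *-monoʳ-≤ (2 ^ t) (wsum-antitone a≤eᵗ (misses-antitone G)) ⟩
  2 ^ t * (2 ^ n * wsum a (e ^ t) (misses G)) ≤⟨ *-monoʳ-≤ (2 ^ t) (*-monoʳ-≤ (2 ^ n) le) ⟩
  2 ^ t * (2 ^ n * M ^ t)        ≡⟨ eq₂ (2 ^ t) (2 ^ n) (M ^ t) ⟩
  2 ^ n * (2 ^ t * M ^ t)        ≡⟨ cong (2 ^ n *_) (^-distribʳ-* t 2 M) ⟨
  2 ^ n * (2 * M) ^ t            ≤⟨ *-monoʳ-≤ (2 ^ n) (^-monoˡ-≤ t misses-sparse) ⟩
  2 ^ n * ((2 * t) ^ n) ^ t      ≡⟨ cong (2 ^ n *_) (trans (^-*-assoc (2 * t) n t) (trans (cong ((2 * t) ^_) (*-comm n t)) (sym (^-*-assoc (2 * t) t n)))) ⟩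
  2 ^ n * dᵗ ^ n                 ∎)
  where
  open ≤-Reasoning
  e = t′ + 1 * t
  open SecondMoment e R v S 3v≤R using (misses-sparse)
  dᵗ = (2 * t) ^ t
  W = wsum 1 1 (misses G)
  M = wsum 1 e (misses G)
  -- (1 - 1/2t)^t ≥ 1/2, so the union of t sets of density 1/2t has density at most 1/2.
  a≤eᵗ : a ≤ e ^ t
  a≤eᵗ = +-cancelʳ-≤ (e ^ t) a (e ^ t) (begin
    a + e ^ t        ≡⟨ trans total (sym (*-identityˡ _)) ⟩
    1 * (2 * t) ^ t  ≤⟨ bernoulli-ratio 1 e t ≤-refl ⟩
    2 * e ^ t        ≡⟨ cong (e ^ t +_) (+-identityʳ (e ^ t)) ⟩
    e ^ t + e ^ t    ∎)
  eq₁ : ∀ w p d → w * p * d ≡ p * (w * d)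
  eq₁ = solve-∀
  eq₂ : ∀ p q m → p * (q * m) ≡ q * (p * m)
  eq₂ = solve-∀

-- Set differences, maximal sets and lists split at an element

⊥-⊑ : ∀ {n} (x : Cube n) → ⊥ ⊑ x ≡ true
⊥-⊑ []      = refl
⊥-⊑ (_ ∷ x) = ⊥-⊑ x

⊑-trans : ∀ {n} (s x y : Cube n) → s ⊑ x ≡ true → x ⊑ y ≡ true → s ⊑ y ≡ true
⊑-trans []          []          []          _ _ = refl
⊑-trans (false ∷ s) (false ∷ x) (_ ∷ y)     p q = ⊑-trans s x y p q
⊑-trans (false ∷ s) (true ∷ x)  (true ∷ y)  p q = ⊑-trans s x y p q
⊑-trans (true ∷ s)  (true ∷ x)  (true ∷ y)  p q = ⊑-trans s x y p q

⊑⇒∣∣≤ : ∀ {n} (s x : Cube n) → s ⊑ x ≡ true → ∣ s ∣ ≤ ∣ x ∣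
⊑⇒∣∣≤ []          []          _ = z≤n
⊑⇒∣∣≤ (false ∷ s) (false ∷ x) p = ⊑⇒∣∣≤ s x p
⊑⇒∣∣≤ (false ∷ s) (true ∷ x)  p = m≤n⇒m≤1+n (⊑⇒∣∣≤ s x p)
⊑⇒∣∣≤ (true ∷ s)  (true ∷ x)  p = s≤s (⊑⇒∣∣≤ s x p)

∣─∣ : ∀ {n} (y s : Cube n) → y ⊑ s ≡ true → ∣ s ─ y ∣ + ∣ y ∣ ≡ ∣ s ∣
∣─∣ []          []          _ = refl
∣─∣ (false ∷ y) (false ∷ s) p = ∣─∣ y s p
∣─∣ (false ∷ y) (true ∷ s)  p = cong suc (∣─∣ y s p)
∣─∣ (true ∷ y)  (true ∷ s)  p = trans (+-suc _ _) (cong suc (∣─∣ y s p))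

⊑─⇒disjoint : ∀ {n} (s y x : Cube n) → s ⊑ (x ─ y) ≡ true → ∣ s ∩ y ∣ ≡ 0
⊑─⇒disjoint []          []          []      _ = refl
⊑─⇒disjoint (false ∷ s) (_ ∷ y)     (_ ∷ x) p = ⊑─⇒disjoint s y x p
⊑─⇒disjoint (true ∷ s)  (false ∷ y) (true ∷ x) p = ⊑─⇒disjoint s y x p

⊑─⇒⊑ : ∀ {n} (s y x : Cube n) → s ⊑ (x ─ y) ≡ true → s ⊑ x ≡ true
⊑─⇒⊑ []          []          []      _ = refl
⊑─⇒⊑ (false ∷ s) (_ ∷ y)     (_ ∷ x) p = ⊑─⇒⊑ s y x p
⊑─⇒⊑ (true ∷ s)  (false ∷ y) (true ∷ x) p = ⊑─⇒⊑ s y x p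

─⊑⇒⊑ : ∀ {n} (s y x : Cube n) → (s ─ y) ⊑ x ≡ true → y ⊑ x ≡ true → s ⊑ x ≡ true
─⊑⇒⊑ []          []          []         _ _ = refl
─⊑⇒⊑ (false ∷ s) (false ∷ y) (_ ∷ x)    p q = ─⊑⇒⊑ s y x p q
─⊑⇒⊑ (false ∷ s) (true ∷ y)  (true ∷ x) p q = ─⊑⇒⊑ s y x p q
─⊑⇒⊑ (true ∷ s)  (false ∷ y) (true ∷ x) p q = ─⊑⇒⊑ s y x p q
─⊑⇒⊑ (true ∷ s)  (true ∷ y)  (true ∷ x) p q = ─⊑⇒⊑ s y x p q

∈-cube : ∀ {n} (x : Cube n) → x ∈ cube n
∈-cube []          = here refl
∈-cube (false ∷ x) = ∈-++⁺ˡ (∈-map⁺ (false ∷_) (∈-cube x))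
∈-cube (true ∷ x)  = ∈-++⁺ʳ (map (false ∷_) (cube _)) (∈-map⁺ (true ∷_) (∈-cube x))

largest : ∀ {n} {P : Cube n → Set} → Decidable P → P ⊥ →
          Σ[ y ∈ Cube n ] (P y × (∀ z → P z → ∣ z ∣ ≤ ∣ y ∣))
largest {n} P? P⊥ = argmax ∣_∣ ⊥ (filter P? (cube n)) , argmax-all ∣_∣ P⊥ (all-filter P? (cube n)) ,
  λ z Pz → All.lookup (f[xs]≤f[argmax] ⊥ (filter P? (cube n))) (∈-filter⁺ P? (∈-cube z) Pz)

module _ {A : Set} where

  Σ-extract : ∀ (q : A → Bool) as → 0 < Σ as (𝟙 ∘ q) →
              Σ[ a ∈ A ] Σ[ bs ∈ List A ] Σ[ cs ∈ List A ] (as ≡ bs ++ a ∷ cs × q a ≡ true)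
  Σ-extract q (a ∷ as) 0<Σ with q a in eq
  ... | true  = a , [] , as , refl , eq
  ... | false with a′ , bs , cs , refl , qa′ ← Σ-extract q as 0<Σ = a′ , a ∷ bs , cs , refl , qa′

  Σ-insert : ∀ (bs : List A) {a cs} h → Σ (bs ++ a ∷ cs) h ≡ h a + Σ (bs ++ cs) h
  Σ-insert []       h = refl
  Σ-insert (b ∷ bs) {a} {cs} h rewrite Σ-insert bs {a} {cs} h = eq (h b) (h a) _
    where
    eq : ∀ x y z → x + (y + z) ≡ y + (x + z)
    eq = solve-∀

  length-Σ : ∀ (as : List A) → length as ≡ Σ as (λ _ → 1)
  length-Σ as = sym (trans (Σ-const as 1) (*-identityʳ (length as)))

  module _ {P : A → Set} (P? : Decidable P) where

    Σ-filter : ∀ as h → Σ (filter P? as) h ≡ Σ as (λ a → 𝟙 (does (P? a)) * h a)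
    Σ-filter []       h = refl
    Σ-filter (a ∷ as) h with does (P? a)
    ... | true  = cong₂ _+_ (sym (+-identityʳ (h a))) (Σ-filter as h)
    ... | false = Σ-filter as h

    length-filter : ∀ as → length (filter P? as) ≡ Σ as (λ a → 𝟙 (does (P? a)))
    length-filter as = trans (length-Σ (filter P? as)) (trans (Σ-filter as _) (Σ-cong as (λ a → *-identityʳ _)))

  ∈-filterᵇ⁻ : ∀ (q : A → Bool) as {a} → a ∈ filterᵇ q as → a ∈ as × q a ≡ true
  ∈-filterᵇ⁻ q (b ∷ as) a∈ with q b in eq
  ∈-filterᵇ⁻ q (b ∷ as) (here refl) | true = here refl , eq
  ∈-filterᵇ⁻ q (b ∷ as) (there a∈)  | true  with a∈as , qa ← ∈-filterᵇ⁻ q as a∈ = there a∈as , qa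
  ∈-filterᵇ⁻ q (b ∷ as) a∈          | false with a∈as , qa ← ∈-filterᵇ⁻ q as a∈ = there a∈as , qa

  ∈-filterᵇ⁺ : ∀ (q : A → Bool) {as a} → a ∈ as → q a ≡ true → a ∈ filterᵇ q as
  ∈-filterᵇ⁺ q (here refl) qa rewrite qa = here refl
  ∈-filterᵇ⁺ q (there {x = b} a∈) qa with q b
  ... | true  = there (∈-filterᵇ⁺ q a∈ qa)
  ... | false = ∈-filterᵇ⁺ q a∈ qa

  ∈-insert : ∀ (bs : List A) {a cs b} → b ∈ bs ++ cs → b ∈ bs ++ a ∷ cs
  ∈-insert bs b∈ with ∈-++⁻ bs b∈
  ... | inj₁ p = ∈-++⁺ˡ p
  ... | inj₂ p = ∈-++⁺ʳ bs (there p)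

Σ-map : ∀ {A B : Set} (f : A → B) as h → Σ (map f as) h ≡ Σ as (h ∘ f)
Σ-map f []       h = refl
Σ-map f (a ∷ as) h = cong (h (f a) +_) (Σ-map f as h)

∧-true : ∀ {a b} → a ∧ b ≡ true → a ≡ true × b ≡ true
∧-true {true} {true} _ = refl , refl

𝟙-mono : ∀ {a b} → (a ≡ true → b ≡ true) → 𝟙 a ≤ 𝟙 b
𝟙-mono {false} a⇒b = z≤n
𝟙-mono {true}  a⇒b rewrite a⇒b refl = ≤-refl

-- Finding a core in a family with many sets of one size

hasSize : ∀ {n} → ℕ → Cube n → Bool
hasSize k s = does (∣ s ∣ ≟ k)

hasSize⇒≡ : ∀ {n} k (s : Cube n) → hasSize k s ≡ true → ∣ s ∣ ≡ k
hasSize⇒≡ k s p = ≡ᵇ⇒≡ ∣ s ∣ k (subst T (sym p) _)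

-- By rare, removing s from F or adding y to F changes the formula on at most 2^(n-t) points.
record Core {n : ℕ} (t k : ℕ) (F : List (Cube n)) : Set where
  field
    {before after} : List (Cube n)
    {s y}    : Cube n
    split    : F ≡ before ++ s ∷ after
    y⊑s      : y ⊑ s ≡ true
    ∣y∣≤k    : ∣ y ∣ ≤ k
    another  : 0 < Σ (before ++ after) (λ s → 𝟙 (y ⊑ s))
    rare     : wsum 1 1 (λ x → 𝟙 (y ⊑ x ∧ not (hits (before ++ after) x))) * 2 ^ t ≤ 2 ^ n

module _ (t R : ℕ) .{{_ : NonZero t}} .{{_ : NonZero R}} where

  private
    r = 2 * t * R

    instance
      r≢0 : NonZero r
      r≢0 = m*n≢0 (2 * t) R {{m*n≢0 2 t}}

  module _ {n : ℕ} (k : ℕ) (3k≤R : 3 * k ≤ R) (F : List (Cube n)) where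

    private
      p : Cube n → Cube n → Bool
      p y s = hasSize k s ∧ y ⊑ s

      -- More than r^(k-∣y∣) sets of size k contain `y`, multiplied out so that it makes sense
      -- before ∣y∣ ≤ k is known.
      Big : Cube n → Set
      Big y = r ^ k < r ^ ∣ y ∣ * Σ F (𝟙 ∘ p y)

    find-core : r ^ k < Σ F (𝟙 ∘ hasSize k) → Core t k F
    find-core many with largest {P = Big} (λ y → r ^ k <? r ^ ∣ y ∣ * Σ F (𝟙 ∘ p y)) big⊥
      where
      big⊥ : Big ⊥
      big⊥ rewrite ∣⊥∣≡0 n = <-≤-trans many (≤-trans
        (Σ-mono F (λ s → 𝟙-mono (λ q → cong₂ _∧_ q (⊥-⊑ s)))) (≤-reflexive (sym (*-identityˡ _))))
    ... | y , big , maximal with Σ-extract (p y) F (n≢0⇒n>0 (λ z → n≮0 (subst (r ^ k <_) (trans (cong (r ^ ∣ y ∣ *_) z) (*-zeroʳ (r ^ ∣ y ∣))) big)))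
    ... | s , bs , cs , refl , ps = record
      { y = y
      ; split = refl
      ; y⊑s = proj₂ (∧-true {hasSize k s} ps)
      ; ∣y∣≤k = y≤k
      ; another = ≤-trans c>0 (Σ-mono F′ (λ s → 𝟙-mono (proj₂ ∘ ∧-true {hasSize k s})))
      ; rare = ≤-trans (*-monoˡ-≤ (2 ^ t) (wsum-mono 1 1 rare-pointwise)) (robust-sunflower t link (≤-trans (*-monoʳ-≤ 3 (m∸n≤m k ∣ y ∣)) (m≤n⇒m≤1+n 3k≤R)))
      }
      where
      open ≤-Reasoning
      F′ G : List (Cube n)
      F′ = bs ++ cs
      G = map (_─ y) (filterᵇ (p y) F′)
      v = k ∸ ∣ y ∣
      c = Σ F′ (𝟙 ∘ p y)

      y≤k : ∣ y ∣ ≤ k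
      y≤k = subst (∣ y ∣ ≤_) (hasSize⇒≡ k s (proj₁ (∧-true {hasSize k s} ps))) (⊑⇒∣∣≤ y s (proj₂ (∧-true {hasSize k s} ps)))

      rᵏ : r ^ k ≡ r ^ ∣ y ∣ * r ^ v
      rᵏ = trans (cong (r ^_) (sym (m+[n∸m]≡n y≤k))) (^-distribˡ-+-* r ∣ y ∣ v)

      -- The strict inequality in `Big` pays for the removal of `s`: c + 1 > r^v.
      c≥ : r ^ v ≤ c
      c≥ = s≤s⁻¹ (*-cancelˡ-< (r ^ ∣ y ∣) _ _ (begin-strict
        r ^ ∣ y ∣ * r ^ v                     ≡⟨ rᵏ ⟨
        r ^ k                                 <⟨ big ⟩
        r ^ ∣ y ∣ * Σ (bs ++ s ∷ cs) (𝟙 ∘ p y) ≡⟨ cong (r ^ ∣ y ∣ *_) (trans (Σ-insert bs _) (cong (λ b → 𝟙 b + c) ps)) ⟩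
        r ^ ∣ y ∣ * suc c                     ∎))

      c>0 : 0 < c
      c>0 = <-≤-trans (m^n>0 r v) c≥

      length-G : length G ≡ c
      length-G = trans (length-map (_─ y) (filterᵇ (p y) F′)) (length-filter (T? ∘ p y) F′)

      Σ-G : ∀ z → Σ G (λ s′ → 𝟙 (z ⊑ s′)) ≡ Σ F′ (λ s → 𝟙 (p y s ∧ z ⊑ (s ─ y)))
      Σ-G z = trans (Σ-map (_─ y) (filterᵇ (p y) F′) _)
        (trans (Σ-filter (T? ∘ p y) F′ _) (Σ-cong F′ (λ s → sym (𝟙-∧ (p y s) _))))

      spread : ∀ z → r ^ ∣ z ∣ * Σ F′ (λ s → 𝟙 (p y s ∧ z ⊑ (s ─ y))) ≤ c
      spread z with ∣ z ∣ in ∣z∣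
      ... | zero = ≤-trans (≤-reflexive (*-identityˡ _)) (Σ-mono F′ (λ s → 𝟙-mono (proj₁ ∘ ∧-true)))
      ... | suc j with ∣ z ∩ y ∣ ≟ 0
      -- A set whose remainder contains `z` contains `z ∪ y`, which is larger than `y` and therefore
      -- not `Big`. Maximality speaks of the whole family, so `s` is put back into the count.
      ...   | yes disjoint = ≤-trans (*-cancelˡ-≤ (r ^ ∣ y ∣) {{m^n≢0 r ∣ y ∣}} (begin
        r ^ ∣ y ∣ * (r ^ suc j * Σ F′ (λ s → 𝟙 (p y s ∧ z ⊑ (s ─ y))))
          ≤⟨ *-monoʳ-≤ (r ^ ∣ y ∣) (*-monoʳ-≤ (r ^ suc j) (Σ-mono F′ (λ s → 𝟙-mono (contains s)))) ⟩
        r ^ ∣ y ∣ * (r ^ suc j * Σ F′ (𝟙 ∘ p (z ∪ y)))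
          ≤⟨ *-monoʳ-≤ (r ^ ∣ y ∣) (*-monoʳ-≤ (r ^ suc j) (≤-trans (m≤n+m _ (𝟙 (p (z ∪ y) s))) (≤-reflexive (sym (Σ-insert bs _))))) ⟩
        r ^ ∣ y ∣ * (r ^ suc j * Σ (bs ++ s ∷ cs) (𝟙 ∘ p (z ∪ y)))
          ≡⟨ eq (r ^ ∣ y ∣) (r ^ suc j) _ ⟩
        r ^ suc j * r ^ ∣ y ∣ * Σ (bs ++ s ∷ cs) (𝟙 ∘ p (z ∪ y))
          ≡⟨ cong (_* Σ (bs ++ s ∷ cs) (𝟙 ∘ p (z ∪ y))) (trans (cong (r ^_) ∣z∪y∣) (^-distribˡ-+-* r (suc j) ∣ y ∣)) ⟨
        r ^ ∣ z ∪ y ∣ * Σ (bs ++ s ∷ cs) (𝟙 ∘ p (z ∪ y))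
          ≤⟨ ≮⇒≥ (λ bigger → <⇒≱ (≤-trans (s≤s (m≤n+m ∣ y ∣ j)) (≤-reflexive (sym ∣z∪y∣))) (maximal (z ∪ y) bigger)) ⟩
        r ^ k
          ≡⟨ rᵏ ⟩
        r ^ ∣ y ∣ * r ^ v ∎)) c≥
        where
        eq : ∀ a b x → a * (b * x) ≡ b * a * x
        eq = solve-∀
        ∣z∪y∣ : ∣ z ∪ y ∣ ≡ suc j + ∣ y ∣
        ∣z∪y∣ = trans (sym (+-identityʳ _)) (trans (cong (∣ z ∪ y ∣ +_) (sym disjoint)) (trans (∣∪∣+∣∩∣ z y) (cong (_+ ∣ y ∣) ∣z∣)))
        contains : ∀ s → p y s ∧ z ⊑ (s ─ y) ≡ true → p (z ∪ y) s ≡ true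
        contains s q with ps , z⊑ ← ∧-true {p y s} q with size , y⊑ ← ∧-true {hasSize k s} ps =
          cong₂ _∧_ size (𝟙-injective (trans (⊑-∪ z y s) (cong₂ (λ a b → 𝟙 a * 𝟙 b) (⊑─⇒⊑ z y s z⊑) y⊑)))
          where
          𝟙-injective : ∀ {b} → 𝟙 b ≡ 1 → b ≡ true
          𝟙-injective {true} _ = refl
      -- No remainder `s ─ y` contains a `z` that meets `y`, so the sum is 0.
      ...   | no meets = ≤-trans (*-monoʳ-≤ (r ^ suc j) (Σ-mono F′ (λ s → 𝟙-mono {b = false} (λ q →
          contradiction (⊑─⇒disjoint z y s (proj₂ (∧-true {p y s} q))) meets))))
          (≤-trans (≤-reflexive (trans (cong (r ^ suc j *_) (trans (Σ-const F′ 0) (*-zeroʳ (length F′)))) (*-zeroʳ (r ^ suc j)))) z≤n)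

      link : Spread (2 * t) R v G
      link = record
        { nonempty = subst (0 <_) (sym length-G) c>0
        ; uniform = uniform
        ; spread = λ z → subst₂ (λ a b → r ^ ∣ z ∣ * a ≤ b) (sym (Σ-G z)) (sym length-G) (spread z)
        }
        where
        uniform : ∀ {s} → s ∈ G → ∣ s ∣ ≡ v
        uniform s∈G with s , s∈ , refl ← ∈-map⁻ (_─ y) s∈G
          with ps ← proj₂ (∈-filterᵇ⁻ (p y) F′ s∈)
          with size , y⊑s ← ∧-true {hasSize k s} ps =
          trans (sym (m+n∸n≡m ∣ s ─ y ∣ ∣ y ∣)) (cong (_∸ ∣ y ∣) (trans (∣─∣ y s y⊑s) (hasSize⇒≡ k s size)))

      -- If `x` contained both `y` and a remainder in `G`, it would contain a set of `F′`.
      rare-pointwise : ∀ x → 𝟙 (y ⊑ x ∧ not (hits F′ x)) ≤ misses G x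
      rare-pointwise x = 𝟙-mono go
        where
        go : y ⊑ x ∧ not (hits F′ x) ≡ true → not (hits G x) ≡ true
        go q with y⊑x , miss ← ∧-true {y ⊑ x} q with hits G x in eq
        ... | false = refl
        ... | true with s , s∈G , s⊑x ← hits-elim G eq with s₀ , s₀∈ , refl ← ∈-map⁻ (_─ y) s∈G
              with s₀∈F′ , _ ← ∈-filterᵇ⁻ (p y) F′ s₀∈
              with () ← trans (sym miss) (cong not (hits-intro s₀∈F′ (─⊑⇒⊑ s₀ y x s⊑x y⊑x)))

-- Iterated compression

_xor⟨_⟩_ : ∀ {n} → List (Cube n) → Cube n → List (Cube n) → ℕ
F xor⟨ x ⟩ G = 𝟙 (hits F x xor hits G x)

distance : ∀ {n} → List (Cube n) → List (Cube n) → ℕ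
distance F G = wsum 1 1 (λ x → F xor⟨ x ⟩ G)

distance-triangle : ∀ {n} (F G H : List (Cube n)) → distance F H ≤ distance F G + distance G H
distance-triangle {n} F G H = ≤-trans (wsum-mono 1 1 (λ x → go (hits F x) (hits G x) (hits H x)))
  (≤-reflexive (wsum-+ 1 1 {n} (λ x → F xor⟨ x ⟩ G) (λ x → G xor⟨ x ⟩ H)))
  where
  go : ∀ a b c → 𝟙 (a xor c) ≤ 𝟙 (a xor b) + 𝟙 (b xor c)
  go true  true  c     = ≤-refl
  go true  false true  = z≤n
  go true  false false = s≤s z≤n
  go false true  true  = s≤s z≤n
  go false true  false = z≤n
  go false false c     = ≤-refl

distance-refl : ∀ {n} (F : List (Cube n)) → distance F F ≡ 0
distance-refl {n} F = trans (wsum-cong 1 1 (λ x → cong 𝟙 (Bool.xor-same (hits F x)))) (wsum-0 1 1 {n})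

Bounded : ∀ {n} → ℕ → List (Cube n) → Set
Bounded w F = ∀ {s} → s ∈ F → ∣ s ∣ ≤ w

⇒-≤ᵇ : ∀ {a b} → (a ≡ true → b ≡ true) → a ≤ᵇ b
⇒-≤ᵇ {false} {false} _   = b≤b
⇒-≤ᵇ {false} {true}  _   = f≤t
⇒-≤ᵇ {true}          a⇒b rewrite a⇒b refl = b≤b

-- The relation `_≼_` is `_≤ᵇ_` for lower approximators and its flip for upper ones, so that one
-- iteration serves both.
record Step {n : ℕ} (_≼_ : Bool → Bool → Set) (t w : ℕ) (F F′ : List (Cube n)) : Set where
  field
    bounded : Bounded w F′
    related : ∀ x → hits F′ x ≼ hits F x
    shorter : length F′ < length F
    close   : distance F′ F * 2 ^ t ≤ 2 ^ n

module _ {n t k w : ℕ} (k≤w : k ≤ w) where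

  lower-step : ∀ {F : List (Cube n)} → Bounded w F → Core t k F → Σ[ F′ ∈ List (Cube n) ] Step _≤ᵇ_ t w F F′
  lower-step bnd record { before = bs ; after = cs ; s = s ; y = y ; split = refl ; y⊑s = y⊑s ; rare = rare } =
    bs ++ cs , record
    { bounded = bnd ∘ ∈-insert bs
    ; related = λ x → ⇒-≤ᵇ (weaker x)
    ; shorter = ≤-reflexive (sym (trans (length-Σ (bs ++ s ∷ cs)) (trans (Σ-insert bs _) (cong suc (sym (length-Σ (bs ++ cs)))))))
    ; close   = ≤-trans (*-monoˡ-≤ (2 ^ t) (wsum-mono 1 1 (λ x → 𝟙-mono (changed x)))) rare
    }
    where
    weaker : ∀ x → hits (bs ++ cs) x ≡ true → hits (bs ++ s ∷ cs) x ≡ true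
    weaker x h with z , z∈ , z⊑x ← hits-elim (bs ++ cs) h = hits-intro (∈-insert bs z∈) z⊑x
    remaining : ∀ {z x} → z ∈ bs ++ s ∷ cs → z ⊑ x ≡ true → hits (bs ++ cs) x ≡ false → s ⊑ x ≡ true
    remaining z∈ z⊑x miss with ∈-++⁻ bs z∈
    ... | inj₁ z∈bs         with () ← trans (sym miss) (hits-intro (∈-++⁺ˡ z∈bs) z⊑x)
    ... | inj₂ (here refl)  = z⊑x
    ... | inj₂ (there z∈cs) with () ← trans (sym miss) (hits-intro (∈-++⁺ʳ bs z∈cs) z⊑x)
    -- A point lost by the deletion contains `s`, hence `y`, and no other set: the event bounded by
    -- `rare`.
    changed : ∀ x → hits (bs ++ cs) x xor hits (bs ++ s ∷ cs) x ≡ true → y ⊑ x ∧ not (hits (bs ++ cs) x) ≡ true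
    changed x q with hits (bs ++ cs) x in eq₁ | hits (bs ++ s ∷ cs) x in eq₂
    ... | true  | false with () ← trans (sym eq₂) (weaker x eq₁)
    ... | false | true with z , z∈ , z⊑x ← hits-elim (bs ++ s ∷ cs) eq₂ =
          cong (_∧ true) (⊑-trans y s x y⊑s (remaining z∈ z⊑x eq₁))

  upper-step : ∀ {F : List (Cube n)} → Bounded w F → Core t k F → Σ[ F′ ∈ List (Cube n) ] Step (flip _≤ᵇ_) t w F F′
  upper-step bnd record { before = bs ; after = cs ; s = s ; y = y ; split = refl ; y⊑s = y⊑s ; ∣y∣≤k = ∣y∣≤k ; another = another ; rare = rare } =
    F′ , record
    { bounded = bounded
    ; related = λ x → ⇒-≤ᵇ (stronger x)
    ; shorter = shorter
    ; close   = ≤-trans (*-monoˡ-≤ (2 ^ t) (wsum-mono 1 1 (λ x → 𝟙-mono (changed x)))) rare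
    }
    where
    F  = bs ++ s ∷ cs
    q : Cube n → Bool
    q z = not (y ⊑ z)
    F′ = y ∷ filterᵇ q F
    bounded : Bounded w F′
    bounded (here refl) = ≤-trans ∣y∣≤k k≤w
    bounded (there z∈)  = bnd (proj₁ (∈-filterᵇ⁻ q F z∈))
    shorter : length F′ < length F
    -- At least two sets disappear, `s` and the one provided by `another`, while only `y` is added.
    shorter = begin-strict
      1 + length (filterᵇ q F)                      ≡⟨ cong suc (length-filter (T? ∘ q) F) ⟩
      1 + Σ F (𝟙 ∘ q)                               <⟨ s≤s (+-monoˡ-≤ (Σ F (𝟙 ∘ q)) another) ⟩
      1 + (Σ (bs ++ cs) (λ z → 𝟙 (y ⊑ z)) + Σ F (𝟙 ∘ q)) ≡⟨ cong (λ b → 𝟙 b + Σ (bs ++ cs) (λ z → 𝟙 (y ⊑ z)) + Σ F (𝟙 ∘ q)) y⊑s ⟨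
      𝟙 (y ⊑ s) + Σ (bs ++ cs) (λ z → 𝟙 (y ⊑ z)) + Σ F (𝟙 ∘ q) ≡⟨ cong (_+ Σ F (𝟙 ∘ q)) (Σ-insert bs _) ⟨
      Σ F (λ z → 𝟙 (y ⊑ z)) + Σ F (𝟙 ∘ q)           ≡⟨ Σ-+ F _ _ ⟨
      Σ F (λ z → 𝟙 (y ⊑ z) + 𝟙 (not (y ⊑ z)))       ≡⟨ Σ-cong F (λ z → 𝟙-+-not (y ⊑ z)) ⟩
      Σ F (λ _ → 1)                                 ≡⟨ length-Σ F ⟨
      length F                                      ∎
      where
      open ≤-Reasoning
    stronger : ∀ x → hits F x ≡ true → hits F′ x ≡ true
    stronger x h with z , z∈ , z⊑x ← hits-elim F h with y ⊑ z in eq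
    ... | true  = hits-intro {F = F′} (here refl) (⊑-trans y z x eq z⊑x)
    ... | false = hits-intro {F = F′} (there (∈-filterᵇ⁺ q z∈ (cong not eq))) z⊑x
    hit-by-y : ∀ {z x} → z ∈ F′ → z ⊑ x ≡ true → hits F x ≡ false → y ⊑ x ≡ true
    hit-by-y (here refl) z⊑x miss = z⊑x
    hit-by-y (there z∈)  z⊑x miss with () ← trans (sym miss) (hits-intro (proj₁ (∈-filterᵇ⁻ q F z∈)) z⊑x)
    still-missed : ∀ x → hits F x ≡ false → not (hits (bs ++ cs) x) ≡ true
    still-missed x miss with hits (bs ++ cs) x in eq
    ... | false = refl
    ... | true with z , z∈ , z⊑x ← hits-elim (bs ++ cs) eq with () ← trans (sym miss) (hits-intro (∈-insert bs z∈) z⊑x)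
    -- A gained point contains `y` and misses all of `F`, in particular what remains without `s`.
    changed : ∀ x → hits F′ x xor hits F x ≡ true → y ⊑ x ∧ not (hits (bs ++ cs) x) ≡ true
    changed x d with hits F′ x in eq₁ | hits F x in eq₂
    ... | false | true with () ← trans (sym eq₁) (stronger x eq₂)
    ... | true  | false with z , z∈ , z⊑x ← hits-elim F′ eq₁ =
          cong₂ _∧_ (hit-by-y z∈ z⊑x eq₂) (still-missed x eq₂)

record Compression {n : ℕ} (_≼_ : Bool → Bool → Set) (t w K m : ℕ) (F F′ : List (Cube n)) : Set where
  field
    bounded : Bounded w F′
    small   : length F′ ≤ K
    related : ∀ x → hits F′ x ≼ hits F x
    close   : distance F′ F * 2 ^ t ≤ m * 2 ^ n

Σ-swap : ∀ {A B : Set} (as : List A) (bs : List B) (h : A → B → ℕ) →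
         Σ as (λ a → Σ bs (h a)) ≡ Σ bs (λ b → Σ as (λ a → h a b))
Σ-swap []       bs h = sym (trans (Σ-const bs 0) (*-zeroʳ (length bs)))
Σ-swap (a ∷ as) bs h = trans (cong (Σ bs (h a) +_) (Σ-swap as bs h)) (sym (Σ-+ bs _ _))

length-by-sizes : ∀ {n} w B (F : List (Cube n)) → Bounded w F →
                  (∀ {k} → k < suc w → Σ F (𝟙 ∘ hasSize k) ≤ B) → length F ≤ suc w * B
length-by-sizes {n} w B F bnd few = begin
  length F                                                  ≡⟨ length-Σ F ⟩
  Σ F (λ _ → 1)                                             ≤⟨ Σ-mono∈ F counted ⟩
  Σ F (λ s → Σ (upTo (suc w)) (λ k → 𝟙 (hasSize k s)))      ≡⟨ Σ-swap F (upTo (suc w)) _ ⟩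
  Σ (upTo (suc w)) (λ k → Σ F (𝟙 ∘ hasSize k))              ≤⟨ Σ-mono∈ (upTo (suc w)) (few ∘ ∈-upTo⁻) ⟩
  Σ (upTo (suc w)) (λ _ → B)                                ≡⟨ Σ-const (upTo (suc w)) B ⟩
  length (upTo (suc w)) * B                                 ≡⟨ cong (_* B) (length-upTo (suc w)) ⟩
  suc w * B                                                 ∎
  where
  open ≤-Reasoning
  counted : ∀ {s} → s ∈ F → 1 ≤ Σ (upTo (suc w)) (λ k → 𝟙 (hasSize k s))
  counted {s} s∈F = ≤-trans (≤-reflexive (cong 𝟙 (sym (dec-true (∣ s ∣ ≟ ∣ s ∣) refl))))
    (Σ-∈ (∈-upTo⁺ (s≤s (bnd s∈F))) (λ k → 𝟙 (hasSize k s)))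

module _ {_≼_ : Bool → Bool → Set} (≼-refl : ∀ {a} → a ≼ a) (≼-trans : ∀ {a b c} → a ≼ b → b ≼ c → a ≼ c)
         {n t R w : ℕ} .{{_ : NonZero t}} .{{_ : NonZero R}} (3w≤R : 3 * w ≤ R)
         (step : ∀ {k} → k ≤ w → ∀ {F : List (Cube n)} → Bounded w F → Core t k F → Σ[ F′ ∈ List (Cube n) ] Step _≼_ t w F F′)
         where

  private
    r = 2 * t * R

  -- `m` is both the recursion measure and the error budget: a step shortens the list and changes
  -- the formula on at most 2^(n-t) points. The recursion stops when every size k ≤ w has at most
  -- r^k sets.
  compress : ∀ m (F : List (Cube n)) → length F ≤ m → Bounded w F →
             Σ[ F′ ∈ List (Cube n) ] Compression _≼_ t w (suc w * r ^ w) m F F′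
  compress m F F≤m bnd with anyUpTo? (λ k → r ^ k <? Σ F (𝟙 ∘ hasSize k)) (suc w)
  ... | no none = F , record
    { bounded = bnd
    ; small   = length-by-sizes w (r ^ w) F bnd (λ {k} k<1+w →
        ≤-trans (≮⇒≥ (λ many → none (k , k<1+w , many))) (^-monoʳ-≤ r {{m*n≢0 (2 * t) R {{m*n≢0 2 t}}}} (s≤s⁻¹ k<1+w)))
    ; related = λ _ → ≼-refl
    ; close   = subst (λ d → d * 2 ^ t ≤ m * 2 ^ n) (sym (distance-refl F)) z≤n
    }
  compress zero F F≤0 bnd | yes (k , _ , many) with [] ← F with () ← many
  compress (suc m) F F≤m bnd | yes (k , k<1+w , many)
    with F′ , s ← step (s≤s⁻¹ k<1+w) bnd (find-core t R k (≤-trans (*-monoʳ-≤ 3 (s≤s⁻¹ k<1+w)) 3w≤R) F many)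
    with F″ , c ← compress m F′ (s≤s⁻¹ (≤-trans (Step.shorter s) F≤m)) (Step.bounded s) = F″ , record
    { bounded = bounded
    ; small   = small
    ; related = λ x → ≼-trans (related x) (Step.related s x)
    ; close   = begin
        distance F″ F * 2 ^ t                             ≤⟨ *-monoˡ-≤ (2 ^ t) (distance-triangle F″ F′ F) ⟩
        (distance F″ F′ + distance F′ F) * 2 ^ t          ≡⟨ *-distribʳ-+ (2 ^ t) (distance F″ F′) _ ⟩
        distance F″ F′ * 2 ^ t + distance F′ F * 2 ^ t    ≤⟨ +-mono-≤ close (Step.close s) ⟩
        m * 2 ^ n + 2 ^ n                                 ≡⟨ +-comm (m * 2 ^ n) (2 ^ n) ⟩
        suc m * 2 ^ n                                     ∎
    }
    where
    open Compression c
    open ≤-Reasoning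

lower-compress : ∀ {n t R w} .{{_ : NonZero t}} .{{_ : NonZero R}} → 3 * w ≤ R → ∀ (F : List (Cube n)) → Bounded w F →
                 Σ[ F′ ∈ List (Cube n) ] Compression _≤ᵇ_ t w (suc w * (2 * t * R) ^ w) (length F) F F′
lower-compress 3w≤R F = compress Bool.≤-refl Bool.≤-trans 3w≤R lower-step (length F) F ≤-refl

upper-compress : ∀ {n t R w} .{{_ : NonZero t}} .{{_ : NonZero R}} → 3 * w ≤ R → ∀ (F : List (Cube n)) → Bounded w F →
                 Σ[ F′ ∈ List (Cube n) ] Compression (flip _≤ᵇ_) t w (suc w * (2 * t * R) ^ w) (length F) F F′
upper-compress 3w≤R F = compress Bool.≤-refl (flip Bool.≤-trans) 3w≤R upper-step (length F) F ≤-refl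

-- Rational bounds, logarithms and the size estimate

fromℕ≡mkℚ : ∀ k → fromℕ k ≡ mkℚ (ℤ.+ k) 0 (coprime-sym (1-coprimeTo k))
fromℕ≡mkℚ k = ℚ.normalize-coprime (coprime-sym (1-coprimeTo k))

-- `fromℕ` normalises by a gcd that does not reduce on a variable, so the computation goes through
-- `fromℕ≡mkℚ` to unnormalised rationals.
fromℕ-* : ∀ a b → fromℕ (a * b) ≡ fromℕ a ℚ.* fromℕ b
fromℕ-* a b = ℚ.toℚᵘ-injective (begin
  toℚᵘ (fromℕ (a * b))                   ≡⟨ cong toℚᵘ (fromℕ≡mkℚ (a * b)) ⟩
  mkℚᵘ (ℤ.+ (a * b)) 0                     ≡⟨ cong (λ i → mkℚᵘ i 0) (ℤ.pos-* a b) ⟩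
  mkℚᵘ (ℤ.+ a) 0 ℚᵘ.* mkℚᵘ (ℤ.+ b) 0         ≡⟨ cong₂ (λ p q → toℚᵘ p ℚᵘ.* toℚᵘ q) (fromℕ≡mkℚ a) (fromℕ≡mkℚ b) ⟨
  toℚᵘ (fromℕ a) ℚᵘ.* toℚᵘ (fromℕ b)     ≈⟨ ℚ.toℚᵘ-homo-* (fromℕ a) (fromℕ b) ⟨
  toℚᵘ (fromℕ a ℚ.* fromℕ b)             ∎)
  where open ℚᵘ.≃-Reasoning

fromℕ-^ : ∀ a k → fromℕ (a ^ k) ≡ fromℕ a ^ℚ k
fromℕ-^ a zero    = refl
fromℕ-^ a (suc k) = trans (fromℕ-* a (a ^ k)) (cong (fromℕ a ℚ.*_) (fromℕ-^ a k))

fromℕ-mono : ∀ {a b} → a ≤ b → fromℕ a ℚ.≤ fromℕ b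
fromℕ-mono {a} {b} a≤b rewrite fromℕ≡mkℚ a | fromℕ≡mkℚ b =
  *≤* (subst₂ ℤ._≤_ (sym (ℤ.*-identityʳ (ℤ.+ a))) (sym (ℤ.*-identityʳ (ℤ.+ b))) (ℤ.+≤+ a≤b))

fromℕ-cancel-≤ : ∀ {a b} → fromℕ a ℚ.≤ fromℕ b → a ≤ b
fromℕ-cancel-≤ {a} {b} le rewrite fromℕ≡mkℚ a | fromℕ≡mkℚ b =
  ℤ.drop‿+≤+ (subst₂ ℤ._≤_ (ℤ.*-identityʳ (ℤ.+ a)) (ℤ.*-identityʳ (ℤ.+ b)) (ℚ.drop-*≤* le))

0≤fromℕ : ∀ k → 0ℚ ℚ.≤ fromℕ k
0≤fromℕ k = fromℕ-mono {0} {k} z≤n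

fromℕ-nonNeg : ∀ k → ℚ.NonNegative (fromℕ k)
fromℕ-nonNeg k = ℚ.nonNegative (0≤fromℕ k)

fromℕ-pos : ∀ k .{{_ : NonZero k}} → Positive (fromℕ k)
fromℕ-pos k = ℚ.normalize-pos k 1

/-*-cancel : ∀ c N .{{_ : NonZero N}} → (ℤ.+ c ℚ./ N) ℚ.* fromℕ N ≡ fromℕ c
/-*-cancel c N@(suc N′) = ℚ.toℚᵘ-injective (begin
  toℚᵘ ((ℤ.+ c ℚ./ N) ℚ.* fromℕ N)            ≈⟨ ℚ.toℚᵘ-homo-* (ℤ.+ c ℚ./ N) (fromℕ N) ⟩
  toℚᵘ (ℤ.+ c ℚ./ N) ℚᵘ.* toℚᵘ (fromℕ N)      ≡⟨ cong (λ p → toℚᵘ (ℤ.+ c ℚ./ N) ℚᵘ.* toℚᵘ p) (fromℕ≡mkℚ N) ⟩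
  toℚᵘ (ℤ.+ c ℚ./ N) ℚᵘ.* mkℚᵘ (ℤ.+ N) 0        ≈⟨ ℚᵘ.*-congʳ (ℚ.toℚᵘ-fromℚᵘ (mkℚᵘ (ℤ.+ c) N′)) ⟩
  mkℚᵘ (ℤ.+ c) N′ ℚᵘ.* mkℚᵘ (ℤ.+ N) 0           ≈⟨ *≡* (trans (ℤ.*-identityʳ _) (cong (λ k → ℤ.+ c ℤ.* ℤ.+ k) (sym (*-identityʳ N)))) ⟩
  mkℚᵘ (ℤ.+ c) 0                              ≡⟨ cong toℚᵘ (fromℕ≡mkℚ c) ⟨
  toℚᵘ (fromℕ c)                            ∎)
  where open ℚᵘ.≃-Reasoning

over⇒≤ : ∀ m ε .{{_ : Positive ε}} k → m over ε ℚ.≤ fromℕ k → fromℕ m ℚ.≤ fromℕ k ℚ.* ε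
over⇒≤ m ε k le = begin
  fromℕ m                            ≡⟨ ℚ.*-identityʳ (fromℕ m) ⟨
  fromℕ m ℚ.* 1ℚ                     ≡⟨ cong (fromℕ m ℚ.*_) (ℚ.*-inverseˡ ε {{ℚ.pos⇒nonZero ε}}) ⟨
  fromℕ m ℚ.* (1/ε ℚ.* ε)            ≡⟨ ℚ.*-assoc (fromℕ m) 1/ε ε ⟨
  (m over ε) ℚ.* ε                   ≤⟨ ℚ.*-monoʳ-≤-nonNeg ε {{ℚ.pos⇒nonNeg ε}} le ⟩
  fromℕ k ℚ.* ε                      ∎
  where
  open ℚ.≤-Reasoning
  1/ε = (ℚ.1/ ε) {{ℚ.pos⇒nonZero ε}}

-- Used with c the number of errors, N = 2^n and K = 2^t: c/N ≤ m/K ≤ ε.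
proportion-≤ : ∀ c N K m ε .{{_ : NonZero N}} .{{_ : NonZero K}} .{{_ : Positive ε}} →
               c * K ≤ m * N → m over ε ℚ.≤ fromℕ K → ℤ.+ c ℚ./ N ℚ.≤ ε
proportion-≤ c N K m ε cK≤mN m/ε≤K = ℚ.*-cancelʳ-≤-pos (fromℕ N) {{fromℕ-pos N}} (ℚ.*-cancelˡ-≤-pos (fromℕ K) {{fromℕ-pos K}} (begin
  fromℕ K ℚ.* ((ℤ.+ c ℚ./ N) ℚ.* fromℕ N)   ≡⟨ cong (fromℕ K ℚ.*_) (/-*-cancel c N) ⟩
  fromℕ K ℚ.* fromℕ c                     ≡⟨ fromℕ-* K c ⟨
  fromℕ (K * c)                           ≤⟨ fromℕ-mono (≤-trans (≤-reflexive (*-comm K c)) cK≤mN) ⟩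
  fromℕ (m * N)                           ≡⟨ fromℕ-* m N ⟩
  fromℕ m ℚ.* fromℕ N                     ≤⟨ ℚ.*-monoʳ-≤-nonNeg (fromℕ N) {{fromℕ-nonNeg N}} (over⇒≤ m ε K m/ε≤K) ⟩
  fromℕ K ℚ.* ε ℚ.* fromℕ N               ≡⟨ ℚ.*-assoc (fromℕ K) ε (fromℕ N) ⟩
  fromℕ K ℚ.* (ε ℚ.* fromℕ N)             ∎))
  where open ℚ.≤-Reasoning

*-mono-≤ℚ : ∀ {a b c d} → 0ℚ ℚ.≤ b → 0ℚ ℚ.≤ c → a ℚ.≤ b → c ℚ.≤ d → a ℚ.* c ℚ.≤ b ℚ.* d
*-mono-≤ℚ {a} {b} {c} {d} 0≤b 0≤c a≤b c≤d =
  ℚ.≤-trans (ℚ.*-monoʳ-≤-nonNeg c {{ℚ.nonNegative 0≤c}} a≤b) (ℚ.*-monoˡ-≤-nonNeg b {{ℚ.nonNegative 0≤b}} c≤d)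

0≤^ : ∀ {x} k → 0ℚ ℚ.≤ x → 0ℚ ℚ.≤ x ^ℚ k
0≤^ zero    0≤x = 0≤fromℕ 1
0≤^ {x} (suc k) 0≤x = subst (ℚ._≤ x ℚ.* x ^ℚ k) (ℚ.*-zeroˡ 0ℚ) (*-mono-≤ℚ 0≤x ℚ.≤-refl 0≤x (0≤^ k 0≤x))

^-monoˡ-≤ℚ : ∀ {x y} k → 0ℚ ℚ.≤ x → x ℚ.≤ y → x ^ℚ k ℚ.≤ y ^ℚ k
^-monoˡ-≤ℚ zero    0≤x x≤y = ℚ.≤-refl
^-monoˡ-≤ℚ (suc k) 0≤x x≤y = *-mono-≤ℚ (ℚ.≤-trans 0≤x x≤y) (0≤^ k 0≤x) x≤y (^-monoˡ-≤ℚ k 0≤x x≤y)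

1^ℚ : ∀ k → 1ℚ ^ℚ k ≡ 1ℚ
1^ℚ zero    = refl
1^ℚ (suc k) = trans (ℚ.*-identityˡ (1ℚ ^ℚ k)) (1^ℚ k)

^-cancelʳ-≤ : ∀ {a b} → 2 ^ a ≤ 2 ^ b → a ≤ b
^-cancelʳ-≤ le = ≮⇒≥ (λ b<a → <⇒≱ (^-monoʳ-< 2 ≤-refl b<a) le)

-- For q = a/b, 2^(jb) ≤ ρ^b ≤ 2^a gives j ≤ a/b; a negative numerator contradicts 1 ≤ q.
log₂-≤ : ∀ j {ρ} q → fromℕ (2 ^ j) ℚ.≤ ρ → 1ℚ ℚ.≤ q → log₂ ρ ≤ q → fromℕ j ℚ.≤ q
log₂-≤ j (mkℚ -[1+ _ ] _ _) _ (*≤* ()) _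
log₂-≤ j {ρ} (mkℚ (ℤ.+ a) b-1 _) 2^j≤ρ _ logρ≤q rewrite fromℕ≡mkℚ j =
  *≤* (subst₂ ℤ._≤_ (ℤ.pos-* j (suc b-1)) (sym (ℤ.*-identityʳ (ℤ.+ a))) (ℤ.+≤+ (^-cancelʳ-≤ (fromℕ-cancel-≤ (begin
    fromℕ (2 ^ (j * suc b-1))       ≡⟨ cong fromℕ (^-*-assoc 2 j (suc b-1)) ⟨
    fromℕ ((2 ^ j) ^ suc b-1)       ≡⟨ fromℕ-^ (2 ^ j) (suc b-1) ⟩
    fromℕ (2 ^ j) ^ℚ suc b-1        ≤⟨ ^-monoˡ-≤ℚ (suc b-1) (0≤fromℕ (2 ^ j)) 2^j≤ρ ⟩
    ρ ^ℚ suc b-1                    ≤⟨ logρ≤q ⟩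
    fromℕ 2 ^ℚ a                    ≡⟨ fromℕ-^ 2 a ⟨
    fromℕ (2 ^ a)                   ∎)))))
  where open ℚ.≤-Reasoning

n≤2^n : ∀ k → k ≤ 2 ^ k
n≤2^n zero    = z≤n
n≤2^n (suc k) = +-mono-≤ (m^n>0 2 k) (≤-trans (n≤2^n k) (m≤m+n _ 0))

archimedean : ∀ ρ → Σ[ k ∈ ℕ ] ρ ℚ.≤ fromℕ k
archimedean ρ@(mkℚ i d-1 _) = ℤ.∣ i ∣ , subst (ρ ℚ.≤_) (sym (fromℕ≡mkℚ ℤ.∣ i ∣)) (*≤* (bound i))
  where
  bound : ∀ i → i ℤ.* ℤ.+ 1 ℤ.≤ ℤ.+ ℤ.∣ i ∣ ℤ.* ℤ.+ suc d-1
  bound (ℤ.+ a)    = subst₂ ℤ._≤_ (sym (ℤ.*-identityʳ (ℤ.+ a))) (ℤ.pos-* a (suc d-1)) (ℤ.+≤+ (m≤m*n a (suc d-1)))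
  bound -[1+ a ] = ℤ.-≤+

-- The least positive exponent is found by searching downwards. Unless it is 1, its predecessor is
-- below log₂ ρ, so the exponent is at most 1 + q ≤ 2q. Positivity is what the amplification by t
-- samples requires.
log₂-ceiling : ∀ ρ → Σ[ t ∈ ℕ ] (ρ ℚ.≤ fromℕ (2 ^ suc t) ×
               (∀ q → 1ℚ ℚ.≤ q → log₂ ρ ≤ q → fromℕ (suc t) ℚ.≤ fromℕ 2 ℚ.* q))
log₂-ceiling ρ = search k (ℚ.≤-trans ρ≤k (fromℕ-mono (≤-trans (n≤2^n k) (m≤m+n _ _))))
  where
  k = proj₁ (archimedean ρ)
  ρ≤k = proj₂ (archimedean ρ)
  double : ∀ q → fromℕ 2 ℚ.* q ≡ q ℚ.+ q
  double q = trans (ℚ.*-distribʳ-+ q 1ℚ 1ℚ) (cong₂ ℚ._+_ (ℚ.*-identityˡ q) (ℚ.*-identityˡ q))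
  suc≡1+ : ∀ t → fromℕ (suc t) ≡ 1ℚ ℚ.+ fromℕ t
  suc≡1+ t = ℚ.toℚᵘ-injective (begin
    toℚᵘ (fromℕ (suc t))          ≡⟨ cong toℚᵘ (fromℕ≡mkℚ (suc t)) ⟩
    mkℚᵘ (ℤ.+ suc t) 0              ≡⟨ cong (λ i → mkℚᵘ (ℤ.+ 1 ℤ.+ i) 0) (ℤ.*-identityʳ (ℤ.+ t)) ⟨
    mkℚᵘ (ℤ.+ 1) 0 ℚᵘ.+ mkℚᵘ (ℤ.+ t) 0 ≡⟨ cong (λ p → mkℚᵘ (ℤ.+ 1) 0 ℚᵘ.+ toℚᵘ p) (fromℕ≡mkℚ t) ⟨
    toℚᵘ 1ℚ ℚᵘ.+ toℚᵘ (fromℕ t)   ≈⟨ ℚ.toℚᵘ-homo-+ 1ℚ (fromℕ t) ⟨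
    toℚᵘ (1ℚ ℚ.+ fromℕ t)         ∎)
    where open ℚᵘ.≃-Reasoning
  search : ∀ k → ρ ℚ.≤ fromℕ (2 ^ suc k) → Σ[ t ∈ ℕ ] (ρ ℚ.≤ fromℕ (2 ^ suc t) ×
           (∀ q → 1ℚ ℚ.≤ q → log₂ ρ ≤ q → fromℕ (suc t) ℚ.≤ fromℕ 2 ℚ.* q))
  search zero le = 0 , le , λ q 1≤q _ → begin
    1ℚ                        ≤⟨ 1≤q ⟩
    q                         ≡⟨ ℚ.+-identityʳ q ⟨
    q ℚ.+ 0ℚ                  ≤⟨ ℚ.+-monoʳ-≤ q (ℚ.≤-trans (0≤fromℕ 1) 1≤q) ⟩
    q ℚ.+ q                   ≡⟨ double q ⟨
    fromℕ 2 ℚ.* q             ∎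
    where open ℚ.≤-Reasoning
  search (suc k) le with ρ ℚ.≤? fromℕ (2 ^ suc k)
  ... | yes le′ = search k le′
  ... | no  gt  = suc k , le , λ q 1≤q logρ≤q → begin
    fromℕ (suc (suc k))       ≡⟨ suc≡1+ (suc k) ⟩
    1ℚ ℚ.+ fromℕ (suc k)      ≤⟨ ℚ.+-mono-≤ 1≤q (log₂-≤ (suc k) q (ℚ.<⇒≤ (ℚ.≰⇒> gt)) 1≤q logρ≤q) ⟩
    q ℚ.+ q                   ≡⟨ double q ⟨
    fromℕ 2 ℚ.* q             ∎
    where open ℚ.≤-Reasoning

-- The base is at most 48 w q, and w q ≥ 2 lets the constant into the exponent: 48 ≤ 2^6 ≤ (w q)^6,
-- which with w q itself makes 7. At w = 0 the bound reads N ≤ 1.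
size-bound : ∀ w t {q N} → N ≤ suc w * (2 * t * (3 * suc w)) ^ w → fromℕ t ℚ.≤ fromℕ 2 ℚ.* q →
             w ≡ 0 ⊎ fromℕ 2 ℚ.≤ fromℕ w ℚ.* q → fromℕ N ℚ.≤ (fromℕ w ℚ.* q) ^ℚ (7 * w)
size-bound zero t N≤ t≤ _ = fromℕ-mono N≤
size-bound w@(suc w′) t {q} {N} N≤ t≤2q (inj₂ 2≤y) = begin
  fromℕ N                              ≤⟨ fromℕ-mono (≤-trans N≤ crude) ⟩
  fromℕ ((24 * w * t) ^ w)             ≡⟨ fromℕ-^ (24 * w * t) w ⟩
  fromℕ (24 * w * t) ^ℚ w              ≤⟨ ^-monoˡ-≤ℚ w (0≤fromℕ (24 * w * t)) base ⟩
  (y ^ℚ 7) ^ℚ w                        ≡⟨ ^-assocʳℚ y 7 w ⟩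
  y ^ℚ (7 * w)                         ∎
  where
  open ℚ.≤-Reasoning
  y = fromℕ w ℚ.* q
  0≤y : 0ℚ ℚ.≤ y
  0≤y = ℚ.≤-trans (0≤fromℕ 2) 2≤y
  suc≤2^ : ∀ k → suc k ≤ 2 ^ k
  suc≤2^ zero    = ≤-refl
  suc≤2^ (suc k) = +-mono-≤ (m^n>0 2 k) (≤-trans (suc≤2^ k) (m≤m+n _ 0))
  -- The factor w + 1 ≤ 2^w moves under the power, and w + 1 ≤ 2w turns 12 (w + 1) t into 24 w t.
  crude : suc w * (2 * t * (3 * suc w)) ^ w ≤ (24 * w * t) ^ w
  crude = ≤-trans (*-monoˡ-≤ (B ^ w) (suc≤2^ w)) (≤-trans (≤-reflexive (sym (^-distribʳ-* w 2 B)))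
    (^-monoˡ-≤ w (≤-trans (m≤m+n (2 * B) (12 * (w′ * t))) (≤-reflexive (eq w′ t)))))
    where
    B = 2 * t * (3 * suc w)
    eq : ∀ w′ t → 2 * (2 * t * (3 * (1 + (1 + w′)))) + 12 * (w′ * t) ≡ 24 * (1 + w′) * t
    eq = solve-∀
  base : fromℕ (24 * w * t) ℚ.≤ y ^ℚ 7
  base = begin
    fromℕ (24 * w * t)                               ≡⟨ fromℕ-* (24 * w) t ⟩
    fromℕ (24 * w) ℚ.* fromℕ t                       ≤⟨ ℚ.*-monoˡ-≤-nonNeg (fromℕ (24 * w)) {{fromℕ-nonNeg (24 * w)}} t≤2q ⟩
    fromℕ (24 * w) ℚ.* (fromℕ 2 ℚ.* q)               ≡⟨ ℚ.*-assoc (fromℕ (24 * w)) (fromℕ 2) q ⟨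
    fromℕ (24 * w) ℚ.* fromℕ 2 ℚ.* q                 ≡⟨ cong (ℚ._* q) (trans (sym (fromℕ-* (24 * w) 2)) (trans (cong fromℕ (eq w)) (fromℕ-* 48 w))) ⟩
    fromℕ 48 ℚ.* fromℕ w ℚ.* q                       ≡⟨ ℚ.*-assoc (fromℕ 48) (fromℕ w) q ⟩
    fromℕ 48 ℚ.* y                                   ≤⟨ ℚ.*-monoʳ-≤-nonNeg y {{ℚ.nonNegative 0≤y}} (fromℕ-mono {48} {64} (m≤m+n 48 16)) ⟩
    fromℕ 2 ^ℚ 6 ℚ.* y                               ≤⟨ ℚ.*-monoʳ-≤-nonNeg y {{ℚ.nonNegative 0≤y}} (^-monoˡ-≤ℚ 6 (0≤fromℕ 2) 2≤y) ⟩
    y ^ℚ 6 ℚ.* y                                     ≡⟨ ℚ.*-comm (y ^ℚ 6) y ⟩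
    y ^ℚ 7                                           ∎
    where
    eq : ∀ w → 24 * w * 2 ≡ 48 * w
    eq = solve-∀

-- The monotone case

record MonotoneSandwich {n : ℕ} (w : ℕ) (ρ : ℚ) (F : List (Cube n)) : Set where
  field
    t             : ℕ
    Fℓ Fᵤ         : List (Cube n)
    precise       : ρ ℚ.≤ fromℕ (2 ^ t)
    lower-bounded : Bounded w Fℓ
    upper-bounded : Bounded w Fᵤ
    lower-small   : length Fℓ ≤[ w ·log₂ ρ ]^ (7 * w)
    upper-small   : length Fᵤ ≤[ w ·log₂ ρ ]^ (7 * w)
    lower         : ∀ x → hits Fℓ x ≤ᵇ hits F x
    upper         : ∀ x → hits F x ≤ᵇ hits Fᵤ x
    lower-close   : distance Fℓ F * 2 ^ t ≤ length F * 2 ^ n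
    upper-close   : distance Fᵤ F * 2 ^ t ≤ length F * 2 ^ n

compression-sandwich : ∀ {n} w ρ (F : List (Cube n)) → Bounded w F →
                       (∀ q → 1ℚ ℚ.≤ q → log₂ ρ ≤ q → w ≡ 0 ⊎ fromℕ 2 ℚ.≤ fromℕ w ℚ.* q) →
                       MonotoneSandwich w ρ F
compression-sandwich w ρ F bnd large
  with t , ρ≤2ᵗ , t≤2log ← log₂-ceiling ρ
  -- 3 (w + 1) in place of 3 w keeps `R` nonzero at w = 0.
  with Fℓ , cℓ ← lower-compress {t = suc t} {R = 3 * suc w} (*-monoʳ-≤ 3 (n≤1+n w)) F bnd
  with Fᵤ , cᵤ ← upper-compress {t = suc t} {R = 3 * suc w} (*-monoʳ-≤ 3 (n≤1+n w)) F bnd = record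
  { t             = suc t
  ; precise       = ρ≤2ᵗ
  ; lower-bounded = Compression.bounded cℓ
  ; upper-bounded = Compression.bounded cᵤ
  ; lower-small   = λ q 1≤q logρ≤q → size-bound w (suc t) (Compression.small cℓ) (t≤2log q 1≤q logρ≤q) (large q 1≤q logρ≤q)
  ; upper-small   = λ q 1≤q logρ≤q → size-bound w (suc t) (Compression.small cᵤ) (t≤2log q 1≤q logρ≤q) (large q 1≤q logρ≤q)
  ; lower         = Compression.related cℓ
  ; upper         = Compression.related cᵤ
  ; lower-close   = Compression.close cℓ
  ; upper-close   = Compression.close cᵤ
  }

one-term-small : ∀ ρ N → N ≤ 1 → N ≤[ 1 ·log₂ ρ ]^ 7
one-term-small ρ N N≤1 q 1≤q _ = begin
  fromℕ N               ≤⟨ fromℕ-mono N≤1 ⟩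
  1ℚ                    ≡⟨ 1^ℚ 7 ⟨
  1ℚ ^ℚ 7               ≤⟨ ^-monoˡ-≤ℚ 7 (0≤fromℕ 1) 1≤q ⟩
  q ^ℚ 7                ≡⟨ cong (_^ℚ 7) (ℚ.*-identityˡ q) ⟨
  (fromℕ 1 ℚ.* q) ^ℚ 7  ∎
  where open ℚ.≤-Reasoning

-- A formula with at most one term approximates itself without error; this settles width 1 with m ≤
-- 1, where the logarithm may be arbitrarily small.
trivial-sandwich : ∀ {n} ρ (F : List (Cube n)) → Bounded 1 F → length F ≤ 1 → MonotoneSandwich 1 ρ F
trivial-sandwich {n} ρ F bnd F≤1 with t , ρ≤2ᵗ , _ ← log₂-ceiling ρ = record
  { t             = suc t
  ; Fℓ            = F
  ; Fᵤ            = F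
  ; precise       = ρ≤2ᵗ
  ; lower-bounded = bnd
  ; upper-bounded = bnd
  ; lower-small   = one-term-small ρ (length F) F≤1
  ; upper-small   = one-term-small ρ (length F) F≤1
  ; lower         = λ _ → Bool.≤-refl
  ; upper         = λ _ → Bool.≤-refl
  ; lower-close   = close
  ; upper-close   = close
  }
  where
  close : distance F F * 2 ^ suc t ≤ length F * 2 ^ n
  close rewrite distance-refl F = z≤n

-- For w = 1 the size bound tends to 1 as ρ = m/ε approaches 2, so no constant factor is available there;
-- but ρ ≤ 4 and m ≥ 2 force ε ≥ 1/2, and one literal and the constant 1 suffice.
coarse-sandwich : ∀ {n} ρ (s s′ : Cube n) F → Bounded 1 (s ∷ s′ ∷ F) → ρ ℚ.≤ fromℕ 4 →
                  MonotoneSandwich 1 ρ (s ∷ s′ ∷ F)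
coarse-sandwich {n} ρ s s′ F bnd ρ≤4 = record
  { t             = 2
  ; Fℓ            = s ∷ []
  ; Fᵤ            = ⊥ ∷ []
  ; precise       = ρ≤4
  ; lower-bounded = λ { (here refl) → bnd (here refl) }
  ; upper-bounded = λ { (here refl) → ≤-trans (≤-reflexive (∣⊥∣≡0 n)) z≤n }
  ; lower-small   = one-term-small ρ 1 ≤-refl
  ; upper-small   = one-term-small ρ 1 ≤-refl
  ; lower         = λ x → ⇒-≤ᵇ (weaker (s ⊑ x))
  ; upper         = λ x → ⇒-≤ᵇ (λ _ → cong (_∨ false) (⊥-⊑ x))
  ; lower-close   = close {s ∷ []} (λ x → lower-changed (s ⊑ x) _)
  ; upper-close   = close {⊥ ∷ []} (λ x → upper-changed (s ⊑ x) _ (⊥-⊑ x))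
  }
  where
  open ≤-Reasoning
  weaker : ∀ a {b} → a ∨ false ≡ true → a ∨ b ≡ true
  weaker true _ = refl
  lower-changed : ∀ a b → 𝟙 ((a ∨ false) xor (a ∨ b)) ≤ 𝟙 (not a)
  lower-changed true  b = z≤n
  lower-changed false b = 𝟙≤1 b
  upper-changed : ∀ a b {c} → c ≡ true → 𝟙 ((c ∨ false) xor (a ∨ b)) ≤ 𝟙 (not a)
  upper-changed true  b refl = z≤n
  upper-changed false b refl = 𝟙≤1 (not b)
  W = wsum 1 1 (λ x → 𝟙 (s ⊑ x))
  V = wsum 1 1 (λ x → 𝟙 (not (s ⊑ x)))
  total : W + V ≡ 2 ^ n
  total = trans (sym (wsum-+ 1 1 {n} _ _)) (trans (wsum-cong 1 1 (λ x → 𝟙-+-not (s ⊑ x))) (wsum-1 1 1 {n}))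
  -- Both approximators err only where `s` fails. As ∣s∣ ≤ 1, that is at most half of the cube, and
  -- half is at most m/4 because m ≥ 2.
  V≤W : V ≤ W
  V≤W = +-cancelˡ-≤ W V W (begin
    W + V           ≡⟨ total ⟩
    2 ^ n           ≡⟨ wsum-⊑ 1 s ⟨
    W * 2 ^ ∣ s ∣   ≤⟨ *-monoʳ-≤ W (^-monoʳ-≤ 2 (bnd (here refl))) ⟩
    W * 2           ≡⟨ eq W ⟩
    W + W           ∎)
    where
    eq : ∀ W → W * 2 ≡ W + W
    eq = solve-∀
  close : ∀ {G} → (∀ x → G xor⟨ x ⟩ (s ∷ s′ ∷ F) ≤ 𝟙 (not (s ⊑ x))) →
          distance G (s ∷ s′ ∷ F) * 4 ≤ suc (suc (length F)) * 2 ^ n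
  close {G} changed = begin
    distance G (s ∷ s′ ∷ F) * 4       ≤⟨ *-monoˡ-≤ 4 (wsum-mono 1 1 changed) ⟩
    V * 4                             ≡⟨ eq V ⟩
    2 * (V + V)                       ≤⟨ *-monoʳ-≤ 2 (+-monoˡ-≤ V V≤W) ⟩
    2 * (W + V)                       ≡⟨ cong (2 *_) total ⟩
    2 * 2 ^ n                         ≤⟨ *-monoˡ-≤ (2 ^ n) (m≤m+n 2 (length F)) ⟩
    suc (suc (length F)) * 2 ^ n      ∎
    where
    eq : ∀ V → V * 4 ≡ 2 * (V + V)
    eq = solve-∀

-- Compression needs w q ≥ 2. For w ≥ 2 this follows from q ≥ 1, for w = 1 and ρ > 4 from q ≥ log₂
-- ρ; the rest of width 1 is done by hand.
monotone-sandwich : ∀ {n} w ρ (F : List (Cube n)) → Bounded w F → MonotoneSandwich w ρ F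
monotone-sandwich 0 ρ F bnd = compression-sandwich 0 ρ F bnd (λ _ _ _ → inj₁ refl)
monotone-sandwich 1 ρ []      bnd = trivial-sandwich ρ [] bnd z≤n
monotone-sandwich 1 ρ (s ∷ []) bnd = trivial-sandwich ρ (s ∷ []) bnd ≤-refl
monotone-sandwich 1 ρ F@(s ∷ s′ ∷ F′) bnd with ρ ℚ.≤? fromℕ 4
... | yes ρ≤4 = coarse-sandwich ρ s s′ F′ bnd ρ≤4
... | no  ρ≰4 = compression-sandwich 1 ρ F bnd (λ q 1≤q logρ≤q →
        inj₂ (subst (fromℕ 2 ℚ.≤_) (sym (ℚ.*-identityˡ q)) (log₂-≤ 2 q (ℚ.<⇒≤ (ℚ.≰⇒> ρ≰4)) 1≤q logρ≤q)))
monotone-sandwich w@(suc (suc _)) ρ F bnd = compression-sandwich w ρ F bnd (λ q 1≤q _ →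
  inj₂ (subst (ℚ._≤ fromℕ w ℚ.* q) (ℚ.*-identityʳ (fromℕ 2))
    (*-mono-≤ℚ (0≤fromℕ w) (0≤fromℕ 1) (fromℕ-mono {2} {w} (s≤s (s≤s z≤n))) 1≤q)))

-- Unate formulas as monotone ones

agree : Bool → Bool → Bool
agree true  b = b
agree false b = not b

orient : ∀ {n} → Cube n → Cube n → Cube n
orient = zipWith agree

-- Flipping a coordinate swaps two halves of the cube, which have equal weight in the uniform
-- measure.
wsum-orient : ∀ {n} (σ : Cube n) g → wsum 1 1 (g ∘ orient σ) ≡ wsum 1 1 g
wsum-orient []          g = refl
wsum-orient (true ∷ σ)  g = cong₂ (λ a b → 1 * a + 1 * b) (wsum-orient σ _) (wsum-orient σ _)
wsum-orient (false ∷ σ) g =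
  trans (cong₂ (λ a b → 1 * a + 1 * b) (wsum-orient σ _) (wsum-orient σ _)) (+-comm (1 * wsum 1 1 (g ∘ (true ∷_))) _)

var : ∀ {n} → Literal n → Fin n
var (pos i) = i
var (neg i) = i

sign : ∀ {n} → Literal n → Bool
sign (pos _) = true
sign (neg _) = false

literal : ∀ {n} → Bool → Fin n → Literal n
literal true  = pos
literal false = neg

evalLiteral-agree : ∀ {n} (l : Literal n) x → evalLiteral l x ≡ agree (sign l) (lookup x (var l))
evalLiteral-agree (pos i) x = refl
evalLiteral-agree (neg i) x = refl

Consistent : ∀ {n} → Cube n → Literal n → Set
Consistent σ l = sign l ≡ lookup σ (var l)

-- Signs are forgotten, since the orientation restores them, and repeated literals merge, so the set
-- can be smaller than the term.
support : ∀ {n} → Term n → Cube n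
support []      = ⊥
support (l ∷ t) = support t [ var l ]≔ true

insert-⊑ : ∀ {n} (s : Cube n) i x → (s [ i ]≔ true) ⊑ x ≡ lookup x i ∧ s ⊑ x
insert-⊑ (false ∷ s) zero    (b ∷ x)     = refl
insert-⊑ (true  ∷ s) zero    (true ∷ x)  = refl
insert-⊑ (true  ∷ s) zero    (false ∷ x) = refl
insert-⊑ (false ∷ s) (suc i) (_ ∷ x)     = insert-⊑ s i x
insert-⊑ (true  ∷ s) (suc i) (true ∷ x)  = insert-⊑ s i x
insert-⊑ (true  ∷ s) (suc i) (false ∷ x) = sym (Bool.∧-zeroʳ (lookup x i))

∣insert∣ : ∀ {n} (s : Cube n) i → ∣ s [ i ]≔ true ∣ ≤ suc ∣ s ∣
∣insert∣ (false ∷ s) zero    = ≤-refl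
∣insert∣ (true  ∷ s) zero    = n≤1+n _
∣insert∣ (false ∷ s) (suc i) = ∣insert∣ s i
∣insert∣ (true  ∷ s) (suc i) = s≤s (∣insert∣ s i)

∣support∣ : ∀ {n} (t : Term n) → ∣ support t ∣ ≤ length t
∣support∣ {n} []      = ≤-reflexive (∣⊥∣≡0 n)
∣support∣     (l ∷ t) = ≤-trans (∣insert∣ (support t) (var l)) (s≤s (∣support∣ t))

support-⊑ : ∀ {n} {σ : Cube n} t → (∀ {l} → l ∈ t → Consistent σ l) → ∀ x → support t ⊑ orient σ x ≡ evalTerm t x
support-⊑ {σ = σ} []      con x = ⊥-⊑ (orient σ x)
support-⊑ {σ = σ} (l ∷ t) con x = trans (insert-⊑ (support t) (var l) (orient σ x))
  (cong₂ _∧_ literal-value (support-⊑ t (con ∘ there) x))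
  where
  literal-value : lookup (orient σ x) (var l) ≡ evalLiteral l x
  literal-value = trans (lookup-zipWith agree (var l) σ x)
    (trans (cong (λ b → agree b (lookup x (var l))) (sym (con (here refl)))) (sym (evalLiteral-agree l x)))

shift : ∀ {n} → Literal n → Literal (suc n)
shift (pos i) = pos (suc i)
shift (neg i) = neg (suc i)

termOf : ∀ {n} → Cube n → Cube n → Term n
termOf []      []          = []
termOf (_ ∷ σ) (false ∷ s) = map shift (termOf σ s)
termOf (b ∷ σ) (true ∷ s)  = literal b zero ∷ map shift (termOf σ s)

evalTerm-shift : ∀ {n} (t : Term n) b x → evalTerm (map shift t) (b ∷ x) ≡ evalTerm t x
evalTerm-shift []          b x = refl
evalTerm-shift (pos i ∷ t) b x = cong (lookup x i ∧_) (evalTerm-shift t b x)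
evalTerm-shift (neg i ∷ t) b x = cong (not (lookup x i) ∧_) (evalTerm-shift t b x)

evalTerm-termOf : ∀ {n} (σ s x : Cube n) → evalTerm (termOf σ s) x ≡ s ⊑ orient σ x
evalTerm-termOf []          []          []      = refl
evalTerm-termOf (_ ∷ σ)     (false ∷ s) (b ∷ x) = trans (evalTerm-shift (termOf σ s) b x) (evalTerm-termOf σ s x)
evalTerm-termOf (true ∷ σ)  (true ∷ s)  (b ∷ x) =
  cong (b ∧_) (trans (evalTerm-shift (termOf σ s) b x) (evalTerm-termOf σ s x))
evalTerm-termOf (false ∷ σ) (true ∷ s)  (b ∷ x) =
  cong (not b ∧_) (trans (evalTerm-shift (termOf σ s) b x) (evalTerm-termOf σ s x))

length-termOf : ∀ {n} (σ s : Cube n) → length (termOf σ s) ≡ ∣ s ∣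
length-termOf []      []          = refl
length-termOf (_ ∷ σ) (false ∷ s) = trans (length-map shift (termOf σ s)) (length-termOf σ s)
length-termOf (_ ∷ σ) (true ∷ s)  = cong suc (trans (length-map shift (termOf σ s)) (length-termOf σ s))

⟦termOf⟧ : ∀ {n} (σ : Cube n) F x → ⟦ map (termOf σ) F ⟧ x ≡ hits F (orient σ x)
⟦termOf⟧ σ []      x = refl
⟦termOf⟧ σ (s ∷ F) x = cong₂ _∨_ (evalTerm-termOf σ s x) (⟦termOf⟧ σ F x)

⟦support⟧ : ∀ {n} {σ : Cube n} f → (∀ {l} → l ∈ concat f → Consistent σ l) →
            ∀ x → hits (map support f) (orient σ x) ≡ ⟦ f ⟧ x
⟦support⟧ []      con x = refl
⟦support⟧ (t ∷ f) con x = cong₂ _∨_ (support-⊑ t (con ∘ ∈-++⁺ˡ) x) (⟦support⟧ f (con ∘ ∈-++⁺ʳ t) x)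

width-termOf : ∀ {n w} (σ : Cube n) F → Bounded w F → width (map (termOf σ) F) ≤ w
width-termOf {w = w} σ F bnd = max≤v⁺ z≤n (All.tabulate go)
  where
  go : ∀ {k} → k ∈ map length (map (termOf σ) F) → k ≤ w
  go k∈ with _ , t∈ , refl ← ∈-map⁻ length k∈ with s , s∈F , refl ← ∈-map⁻ (termOf σ) t∈ =
    ≤-trans (≤-reflexive (length-termOf σ s)) (bnd s∈F)

support-bounded : ∀ {n w} (f : DNF n) → width f ≤ w → Bounded w (map support f)
support-bounded f width≤w s∈ with t , t∈f , refl ← ∈-map⁻ support s∈ =
  ≤-trans (∣support∣ t) (≤-trans (All.lookup (xs≤max 0 (map length f)) (∈-map⁺ length t∈f)) width≤w)

_≟ᴸ_ : ∀ {n} → DecidableEquality (Literal n)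
pos i ≟ᴸ pos j = map′ (cong pos) (λ { refl → refl }) (i Fin.≟ j)
neg i ≟ᴸ neg j = map′ (cong neg) (λ { refl → refl }) (i Fin.≟ j)
pos i ≟ᴸ neg j = no λ ()
neg i ≟ᴸ pos j = no λ ()

-- A variable is flipped exactly when it occurs negated; unateness makes this sign right for all its
-- occurrences.
orientation : ∀ {n} → DNF n → Cube n
orientation f = tabulate (λ i → not (does (neg i ∈? concat f)))
  where open DecMembership _≟ᴸ_ using (_∈?_)

orientation-consistent : ∀ {n} (f : DNF n) → Unate f → ∀ {l} → l ∈ concat f → Consistent (orientation f) l
orientation-consistent f unate {pos i} l∈ = sym (trans (lookup∘tabulate _ i)
  (cong not (dec-false (neg i ∈? concat f) (λ neg∈ → unate i (l∈ , neg∈)))))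
  where open DecMembership _≟ᴸ_ using (_∈?_)
orientation-consistent f unate {neg i} l∈ = sym (trans (lookup∘tabulate _ i)
  (cong not (dec-true (neg i ∈? concat f) l∈)))
  where open DecMembership _≟ᴸ_ using (_∈?_)

-- Error probabilities as counts over the cube, and the theorem

Σ-++ : ∀ {A : Set} (as bs : List A) h → Σ (as ++ bs) h ≡ Σ as h + Σ bs h
Σ-++ []       bs h = refl
Σ-++ (a ∷ as) bs h = trans (cong (h a +_) (Σ-++ as bs h)) (sym (+-assoc (h a) _ _))

Σ-cube : ∀ {n} (g : Cube n → ℕ) → Σ (cube n) g ≡ wsum 1 1 g
Σ-cube {zero}  g = +-identityʳ (g [])
Σ-cube {suc n} g = trans (Σ-++ (map (false ∷_) (cube n)) _ g) (cong₂ _+_ (half false) (half true))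
  where
  half : ∀ b → Σ (map (b ∷_) (cube n)) g ≡ 1 * wsum 1 1 (g ∘ (b ∷_))
  half b = trans (Σ-map (b ∷_) (cube n) g) (trans (Σ-cube (g ∘ (b ∷_))) (sym (*-identityˡ _)))

count-differs : ∀ {n} (g f : Cube n → Bool) →
                length (filter (g differs? f) (cube n)) ≡ wsum 1 1 (λ x → 𝟙 (g x xor f x))
count-differs {n} g f = trans (length-filter (g differs? f) (cube n))
  (trans (Σ-cube {n} _) (wsum-cong 1 1 (λ x → cong 𝟙 (differs-xor (g x) (f x)))))
  where
  differs-xor : ∀ a b → not (does (a Bool.≟ b)) ≡ a xor b
  differs-xor true  true  = refl
  differs-xor true  false = refl
  differs-xor false true  = refl
  differs-xor false false = refl

theorem2p1 : Σ[ C ∈ ℕ ]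
    (∀ (n w m : ℕ) (f : DNF n) → Unate f → width f ≤ w → size f ≡ m →
    ∀ (ε : ℚ) .{{_ : Positive ε}} →
    Σ[ fℓ ∈ DNF n ] Σ[ fᵤ ∈ DNF n ]
    ( (width fℓ ≤ w × size fℓ ≤[ w ·log₂ (m over ε) ]^ (C * w))
    × (width fᵤ ≤ w × size fᵤ ≤[ w ·log₂ (m over ε) ]^ (C * w))
    × Sandwiching ε ⟦ fℓ ⟧ ⟦ fᵤ ⟧ ⟦ f ⟧))
theorem2p1 = 7 , λ { n w m f unate width≤w refl ε → conclude n w f unate width≤w ε }
  where
  conclude : ∀ n w (f : DNF n) → Unate f → width f ≤ w → ∀ ε .{{_ : Positive ε}} →
    Σ[ fℓ ∈ DNF n ] Σ[ fᵤ ∈ DNF n ]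
    ( (width fℓ ≤ w × size fℓ ≤[ w ·log₂ (size f over ε) ]^ (7 * w))
    × (width fᵤ ≤ w × size fᵤ ≤[ w ·log₂ (size f over ε) ]^ (7 * w))
    × Sandwiching ε ⟦ fℓ ⟧ ⟦ fᵤ ⟧ ⟦ f ⟧)
  conclude n w f unate width≤w ε =
    map (termOf σ) Fℓ , map (termOf σ) Fᵤ ,
    (width-termOf σ Fℓ lower-bounded , resize Fℓ lower-small) ,
    (width-termOf σ Fᵤ upper-bounded , resize Fᵤ upper-small) , record
    { lower       = λ x → subst₂ _≤ᵇ_ (sym (⟦termOf⟧ σ Fℓ x)) (same x) (lower (orient σ x))
    ; upper       = λ x → subst₂ _≤ᵇ_ (same x) (sym (⟦termOf⟧ σ Fᵤ x)) (upper (orient σ x))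
    ; lower-error = error Fℓ lower-close
    ; upper-error = error Fᵤ upper-close
    }
    where
    σ = orientation f
    F = map support f
    open MonotoneSandwich (monotone-sandwich w (size f over ε) F (support-bounded f width≤w))
    same : ∀ x → hits F (orient σ x) ≡ ⟦ f ⟧ x
    same = ⟦support⟧ f (orientation-consistent f unate)
    resize : ∀ G → length G ≤[ w ·log₂ (size f over ε) ]^ (7 * w) →
             size (map (termOf σ) G) ≤[ w ·log₂ (size f over ε) ]^ (7 * w)
    resize G = subst (_≤[ w ·log₂ (size f over ε) ]^ (7 * w)) (sym (length-map (termOf σ) G))
    error : ∀ G → distance G F * 2 ^ t ≤ length F * 2 ^ n → Pr (⟦ map (termOf σ) G ⟧ differs? ⟦ f ⟧) ℚ.≤ ε
    error G close = proportion-≤ (length (filter (⟦ map (termOf σ) G ⟧ differs? ⟦ f ⟧) (cube n))) (2 ^ n) (2 ^ t) (size f) ε {{m^n≢0 2 n}} {{m^n≢0 2 t}}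
      (subst₂ (λ c k → c * 2 ^ t ≤ k * 2 ^ n) (sym count) (length-map support f) close) precise
      where
      count : length (filter (⟦ map (termOf σ) G ⟧ differs? ⟦ f ⟧) (cube n)) ≡ distance G F
      -- Errors of the unate formulas are counted at `x`, those of the monotone ones at
      -- `orient σ x`; `wsum-orient` identifies the two counts.
      count = trans (count-differs ⟦ map (termOf σ) G ⟧ ⟦ f ⟧)
        (trans (wsum-cong 1 1 (λ x → cong 𝟙 (cong₂ _xor_ (⟦termOf⟧ σ G x) (sym (same x)))))
          (wsum-orient σ (λ x → G xor⟨ x ⟩ F)))
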